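{- Let $k,N\in\mathbb{N}$ and let $\mathcal{F}$ be a nonempty collection of $k$-colourings of $E(K_N)$. For any $\varepsilon>0$ there exist constants $C_0,n_0>0$, depending only on $(\varepsilon,k,N)$, such that for every $n\ge n_0$ there exists a collection $\mathcal{T}_n$ of $k$-colouring templates for $K_n$ satisfying: (i) $\mathcal{T}_n$ is a container family for $\mathrm{Forb}(\mathcal{F})_n$, i.e. for every template $t$ of $K_n$ with $\langle t\rangle\subseteq \mathrm{Forb}(\mathcal{F})_n$ there exists $t'\in\mathcal{T}_n$ with $t(e)\subseteq t'(e)$ for every $e\in E(K_n)$; (ii) for each $t\in\mathcal{T}_n$ there are at most $\varepsilon\binom{n}{N}$ pairs $(\phi,c)$ with $\phi\in\binom{K_n}{K_N}$, $c\in\mathcal{F}$ and $c\in\langle t_{|\phi}\rangle$; (iii) $\log_k|\mathcal{T}_n|\le \dfrac{C_0}{n^{1/(2\binom{N}{2}-1)}}\binom{n}{2}$.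
   Context: $K_n$ is the complete graph on $[n]=\{1,\dots,n\}$, with $E(K_n)=[n]^{(2)}$. A $k$-colouring of $K_n$ is a map $c:E(K_n)\to[k]$. For $m\le n$, $\binom{K_n}{K_m}$ denotes the set of order-preserving injections $\phi:[m]\to[n]$; for a $k$-colouring $c$ of $K_n$, $c_{|\phi}$ is the $k$-colouring of $K_m$ given by $c_{|\phi}(ij)=c(\phi(i)\phi(j))$. A ($k$-colouring) template for $K_n$ is a map $t:E(K_n)\to 2^{[k]}\setminus\{\emptyset\}$; $t_{|\phi}$ is defined by $t_{|\phi}(ij)=t(\phi(i)\phi(j))$; $\langle t\rangle$ is the set of $k$-colourings $c$ with $c(e)\in t(e)$ for all $e$. For a family $\mathcal{F}$ of $k$-colourings of $K_N$, $\mathrm{Forb}(\mathcal{F})_n$ is the set of $k$-colourings $c$ of $K_n$ such that $c_{|\phi}\notin\mathcal{F}$ for all $\phi\in\binom{K_n}{K_N}$. -}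

module Defs where

open import Data.Nat using (ℕ; zero; suc; _+_; _*_; _∸_; _^_; _≤_)
open import Data.Nat.Combinatorics using (_C_)
open import Data.Fin using (Fin) renaming (_<_ to _<ᶠ_)
open import Data.Fin.Subset using (Subset; _∈_; _⊆_; Nonempty)
open import Data.List using (List; length)
open import Data.List.Relation.Unary.All using (All)
open import Data.List.Relation.Unary.Any using (Any)
open import Data.List.Relation.Unary.AllPairs using (AllPairs)
open import Data.List.Membership.Propositional renaming (_∈_ to _∈ˡ_)
open import Data.Product using (Σ; ∃; _×_; _,_; proj₁; proj₂)
open import Relation.Nullary using (¬_)
open import Relation.Binary.PropositionalEquality using (_≡_)

-- A k-colouring of K_n. Edges of K_n are the pairs i < j in Fin n;
-- the values c i j with ¬ (i < j) are irrelevant junk, so colourings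
-- are always compared up to agreement on edges (_≈E_).
Colouring : ℕ → ℕ → Set
Colouring n k = Fin n → Fin n → Fin k

_≈E_ : ∀ {n k} → Colouring n k → Colouring n k → Set
_≈E_ {n} c d = ∀ (i j : Fin n) → i <ᶠ j → c i j ≡ d i j

IsEmbedding : ∀ {m n} → (Fin m → Fin n) → Set
IsEmbedding {m} φ = ∀ (i j : Fin m) → i <ᶠ j → φ i <ᶠ φ j

restrict : ∀ {m n k} → Colouring n k → (Fin m → Fin n) → Colouring m k
restrict c φ i j = c (φ i) (φ j)

Template : ℕ → ℕ → Set
Template n k = Σ (Fin n → Fin n → Subset k)
                 (λ t → ∀ (i j : Fin n) → i <ᶠ j → Nonempty (t i j))


_∈⟨_⟩ : ∀ {n k} → Colouring n k → (Fin n → Fin n → Subset k) → Set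
_∈⟨_⟩ {n} c t = ∀ (i j : Fin n) → i <ᶠ j → c i j ∈ t i j

_∈𝓕_ : ∀ {N k} → Colouring N k → List (Colouring N k) → Set
c ∈𝓕 F = Any (λ f → c ≈E f) F

InForb : ∀ {N n k} → List (Colouring N k) → Colouring n k → Set
InForb {N} {n} F c =
  ∀ (φ : Fin N → Fin n) → IsEmbedding φ → ¬ (restrict c φ ∈𝓕 F)

⟨_⟩⊆Forb : ∀ {N n k} → Template n k → List (Colouring N k) → Set
⟨_⟩⊆Forb {N} {n} {k} t F = ∀ (c : Colouring n k) → c ∈⟨ proj₁ t ⟩ → InForb F c

_≤T_ : ∀ {n k} → Template n k → Template n k → Set
_≤T_ {n} t t' = ∀ (i j : Fin n) → i <ᶠ j → proj₁ t i j ⊆ proj₁ t' i j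

IsContainerFamily : ∀ {N n k} → List (Colouring N k) → List (Template n k) → Set
IsContainerFamily {N} {n} {k} F 𝓣 =
  ∀ (t : Template n k) → ⟨ t ⟩⊆Forb F → Σ (Template n k) λ t' → (t' ∈ˡ 𝓣) × (t ≤T t')

Pair : ℕ → ℕ → ℕ → Set
Pair N n k = (Fin N → Fin n) × Colouring N k

GoodPair : ∀ {N n k} → List (Colouring N k) → Template n k → Pair N n k → Set
GoodPair F t (φ , c) =
  IsEmbedding φ × (c ∈𝓕 F) × c ∈⟨ (λ i j → proj₁ t (φ i) (φ j)) ⟩

DistinctPairs : ∀ {N n k} → Pair N n k → Pair N n k → Set
DistinctPairs (φ , c) (ψ , d) = ¬ ((∀ i → φ i ≡ ψ i) × (c ≈E d))

-- (ii) "there are at most ε·binom(n,N) such pairs", with ε = (suc p)/(suc q):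
-- every list of pairwise distinct such pairs has length L with
-- L * (suc q) ≤ (suc p) * binom(n,N)
FewPairs : ∀ {N n k} → List (Colouring N k) → Template n k → (p q : ℕ) → Set
FewPairs {N} {n} {k} F t p q =
  ∀ (ps : List (Pair N n k)) → AllPairs DistinctPairs ps → All (GoodPair F t) ps
  → length ps * suc q ≤ suc p * (n C N)

-- log_k X ≤ C0 * binom(n,2) / n^{1/m}, stated exactly via rational upper
-- bounds a/b of the right-hand side: for all a, b ≥ 1 with
-- (a/b)^m ≥ (C0 * binom(n,2))^m / n, we have X^b ≤ k^a.
LogBound : (k X C0 n m : ℕ) → Set
LogBound k X C0 n m =
  ∀ (a b : ℕ) → (C0 * (n C 2) * suc b) ^ m ≤ a ^ m * n → X ^ suc b ≤ k ^ a

{-# OPTIONS --safe #-}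

-- A template t with ⟨t⟩ ⊆ Forb(𝓕) contains no copy of a member of 𝓕. Starting from the full
-- template T, the edges e of K_N are processed one at a time, keeping t ⊆ T, so that after each
-- step there are few copies with the processed edges in T and the remaining ones in t.
-- Processing e: each placement w of K_N in K_n "hits" those points x (an edge of K_n with a
-- colour) for which moving e onto x turns w into a copy with the processed edges in T and the
-- unprocessed ones in t. A greedy choice of few placements hits all but a few of the pairs (x , w)
-- while hitting few points of t; delete from T the hit points that are not in t. The new T is
-- determined by the chosen placements, the restriction of t to edges meeting them, and the few
-- exceptional points of t, hence there are few containers.
-- With r = N C 2 edges and E ≈ n^(1/(4(2r-1))), the step with s edges still to come uses at most
-- E^(5s+1) placements and O(n²/E⁵) exceptions; this fits since 5r + 5 ≤ 4(2r - 1) for r ≥ 3.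

module Submission where

open import Defs
open import Data.Bool as Bool using (Bool; true; false; not; _∧_; _∨_)
open import Data.Bool.ListAction using (any; all)
open import Data.Bool.Properties using (∧-comm)
open import Data.Empty using (⊥-elim)
open import Data.Fin as Fin using (Fin; zero; suc)
import Data.Fin.Properties as Finₚ
open import Data.Fin.Subset using (Subset; Nonempty) renaming (_∈_ to _∈ˢ_)
open import Data.Fin.Subset.Properties using (nonempty?)
open import Data.List using (List; []; _∷_; _++_; _ʳ++_; length; map; concatMap; filter; tabulate; allFin; cartesianProduct; cartesianProductWith)
open import Data.List.Membership.Propositional using (_∈_; lose)
import Data.List.Membership.DecPropositional as DecMembership
open import Data.List.Membership.Propositional.Properties using (∈-map⁺; ∈-++⁺ˡ; ∈-++⁺ʳ; ∈-++⁻; ∈-∃++; ∈-allFin; ∈-filter⁺; ∈-filter⁻; ∈-concatMap⁺; ∈-concatMap⁻; ∈-cartesianProduct⁺; ∈-cartesianProductWith⁺)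
open import Data.List.Properties using (length-++; length-map; length-tabulate)
open import Data.List.Relation.Unary.All as All using (All; []; _∷_)
import Data.List.Relation.Unary.All.Properties as Allₚ
open import Data.List.Relation.Unary.AllPairs as AllPairs using (AllPairs; []; _∷_)
import Data.List.Relation.Unary.AllPairs.Properties as AllPairsₚ
open import Data.List.Relation.Unary.Any as Any using (Any; here; there)
open import Data.Nat using (ℕ; zero; suc; _+_; _*_; _∸_; _^_; _!; _≤_; _<_; z≤n; s≤s; _≤?_; _<?_; NonZero; >-nonZero)
open import Data.Nat.Combinatorics using (_C_; nC1≡n; nCk+nC[k+1]≡[n+1]C[k+1]; nCk≡n!/k![n-k]!; k![n∸k]!∣n!)
open import Data.Nat.DivMod using (_/_; m/n*n≡m; m/n*n≤m; m*n/n≡m; /-monoˡ-≤)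
open import Data.Nat.Properties
open import Data.Nat.Tactic.RingSolver using (solve-∀)
open import Data.Product as Product using (Σ; ∃; _×_; _,_; proj₁; proj₂)
open import Data.Product.Properties using (≡-dec)
open import Data.Sum using (_⊎_; inj₁; inj₂)
open import Data.Vec as Vec using (Vec; []; _∷_; lookup; _[_]≔_)
open import Data.Vec.Properties using (lookup∘update; lookup∘update′; lookup∘tabulate; []=⇒lookup; lookup⇒[]=)
open import Function using (_∘_; id)
open import Relation.Binary using (DecidableEquality; tri<; tri≈; tri>)
open import Relation.Binary.PropositionalEquality using (_≡_; _≢_; refl; sym; trans; cong; cong₂; subst; subst₂; module ≡-Reasoning)
open import Relation.Nullary using (Dec; yes; no; does; ¬_)
open import Relation.Nullary.Decidable using (dec-true; dec-false; _×-dec_; _→-dec_)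

private variable
  A A′ A″ : Set

-- Sums over lists

∑ : List A → (A → ℕ) → ℕ
∑ []       f = 0
∑ (x ∷ xs) f = f x + ∑ xs f

𝟙 : Bool → ℕ
𝟙 true  = 1
𝟙 false = 0

∑-cong : ∀ (xs : List A) {f g : A → ℕ} → (∀ x → f x ≡ g x) → ∑ xs f ≡ ∑ xs g
∑-cong []       f≗g = refl
∑-cong (x ∷ xs) f≗g = cong₂ _+_ (f≗g x) (∑-cong xs f≗g)

∑-mono : ∀ (xs : List A) {f g : A → ℕ} → (∀ x → f x ≤ g x) → ∑ xs f ≤ ∑ xs g
∑-mono []       f≤g = z≤n
∑-mono (x ∷ xs) f≤g = +-mono-≤ (f≤g x) (∑-mono xs f≤g)

∑-const : ∀ (xs : List A) c → ∑ xs (λ _ → c) ≡ length xs * c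
∑-const []       c = refl
∑-const (x ∷ xs) c = cong (c +_) (∑-const xs c)

∑-+ : ∀ (xs : List A) (f g : A → ℕ) → ∑ xs (λ x → f x + g x) ≡ ∑ xs f + ∑ xs g
∑-+ []       f g = refl
∑-+ (x ∷ xs) f g = trans (cong (f x + g x +_) (∑-+ xs f g)) (shuffle (f x) (g x) _ _)
  where
  shuffle : ∀ a b c d → a + b + (c + d) ≡ a + c + (b + d)
  shuffle = solve-∀

∑-* : ∀ (xs : List A) c (f : A → ℕ) → ∑ xs (λ x → c * f x) ≡ c * ∑ xs f
∑-* []       c f = sym (*-zeroʳ c)
∑-* (x ∷ xs) c f = trans (cong (c * f x +_) (∑-* xs c f)) (sym (*-distribˡ-+ c (f x) _))

∑-zero : ∀ (xs : List A) → ∑ xs (λ _ → 0) ≡ 0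
∑-zero xs = trans (∑-const xs 0) (*-zeroʳ (length xs))

∑-swap : ∀ (xs : List A) (ys : List A′) (f : A → A′ → ℕ) →
         ∑ xs (λ x → ∑ ys (f x)) ≡ ∑ ys (λ y → ∑ xs (λ x → f x y))
∑-swap []       ys f = sym (∑-zero ys)
∑-swap (x ∷ xs) ys f = trans (cong (∑ ys (f x) +_) (∑-swap xs ys f)) (sym (∑-+ ys (f x) _))

∑-++ : ∀ (xs ys : List A) f → ∑ (xs ++ ys) f ≡ ∑ xs f + ∑ ys f
∑-++ []       ys f = refl
∑-++ (x ∷ xs) ys f = trans (cong (f x +_) (∑-++ xs ys f)) (sym (+-assoc (f x) _ _))

∑-map : ∀ (g : A′ → A) xs (f : A → ℕ) → ∑ (map g xs) f ≡ ∑ xs (λ x → f (g x))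
∑-map g []       f = refl
∑-map g (x ∷ xs) f = cong (f (g x) +_) (∑-map g xs f)

∑-cartesianProductWith : ∀ (h : A → A′ → A″) (xs : List A) (ys : List A′) f →
                         ∑ (cartesianProductWith h xs ys) f ≡ ∑ xs (λ x → ∑ ys (λ y → f (h x y)))
∑-cartesianProductWith h []       ys f = refl
∑-cartesianProductWith h (x ∷ xs) ys f = trans (∑-++ (map (h x) ys) _ f)
  (cong₂ _+_ (∑-map (h x) ys f) (∑-cartesianProductWith h xs ys f))

∑-<⇒∃ : ∀ (xs : List A) (f g : A → ℕ) → ∑ xs f < ∑ xs g → ∃ λ x → x ∈ xs × f x < g x
∑-<⇒∃ (x ∷ xs) f g lt with f x <? g x
... | yes fx<gx = x , here refl , fx<gx
... | no  fx≮gx with ∑-<⇒∃ xs f g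
      (+-cancelˡ-< (f x) _ _ (<-≤-trans lt (+-monoˡ-≤ _ (≮⇒≥ fx≮gx))))
...   | y , y∈xs , fy<gy = y , there y∈xs , fy<gy

𝟙-mono : ∀ {a b} → (a ≡ true → b ≡ true) → 𝟙 a ≤ 𝟙 b
𝟙-mono {false}     a⇒b = z≤n
𝟙-mono {true}  {b} a⇒b rewrite a⇒b refl = ≤-refl

-- Greedy hitting in a bipartite relation

module Greedy {X W : Set} (xs : List X) (ws : List W) (R : X → W → Bool) (t : X → Bool) where

  degree : X → ℕ
  degree x = ∑ ws λ w → 𝟙 (R x w)

  hit : List W → X → Bool
  hit L x = any (R x) L

  unhitDegree : List W → ℕ
  unhitDegree L = ∑ xs λ x → 𝟙 (not (hit L x)) * degree x

  #hit : List W → ℕ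
  #hit L = ∑ xs λ x → 𝟙 (hit L x)

  #hit∩t : List W → ℕ
  #hit∩t L = ∑ xs λ x → 𝟙 (hit L x ∧ t x)

  private
    ∣X∣ = length xs
    ∣W∣ = length ws

    gain : List W → W → ℕ
    gain L w = ∑ xs λ x → 𝟙 (not (hit L x)) * 𝟙 (R x w)

    gain∩t : List W → W → ℕ
    gain∩t L w = ∑ xs λ x → 𝟙 (not (hit L x)) * (𝟙 (t x) * 𝟙 (R x w))

    #hit-∷ : ∀ w L → #hit (w ∷ L) ≡ #hit L + gain L w
    #hit-∷ w L = trans (∑-cong xs (λ x → pointwise (R x w) (hit L x))) (∑-+ xs _ _)
      where
      pointwise : ∀ a h → 𝟙 (a ∨ h) ≡ 𝟙 h + 𝟙 (not h) * 𝟙 a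
      pointwise true  true  = refl
      pointwise true  false = refl
      pointwise false true  = refl
      pointwise false false = refl

    #hit∩t-∷ : ∀ w L → #hit∩t (w ∷ L) ≡ #hit∩t L + gain∩t L w
    #hit∩t-∷ w L = trans (∑-cong xs (λ x → pointwise (R x w) (hit L x) (t x))) (∑-+ xs _ _)
      where
      pointwise : ∀ a h b → 𝟙 ((a ∨ h) ∧ b) ≡ 𝟙 (h ∧ b) + 𝟙 (not h) * (𝟙 b * 𝟙 a)
      pointwise true  true  true  = refl
      pointwise true  true  false = refl
      pointwise true  false true  = refl
      pointwise true  false false = refl
      pointwise false true  true  = refl
      pointwise false true  false = refl
      pointwise false false true  = refl
      pointwise false false false = refl

    ∑-gain : ∀ L → ∑ ws (gain L) ≡ unhitDegree L
    ∑-gain L = trans (∑-swap ws xs _) (∑-cong xs λ x → ∑-* ws (𝟙 (not (hit L x))) _)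

    ∑-gain∩t : ∀ L → ∑ ws (gain∩t L) ≤ ∑ xs (λ x → 𝟙 (t x) * degree x)
    ∑-gain∩t L = ≤-trans (≤-reflexive (∑-swap ws xs _)) (∑-mono xs λ x → begin
      ∑ ws (λ w → 𝟙 (not (hit L x)) * (𝟙 (t x) * 𝟙 (R x w)))  ≤⟨ ∑-mono ws (λ w → drop (not (hit L x)) _) ⟩
      ∑ ws (λ w → 𝟙 (t x) * 𝟙 (R x w))                        ≡⟨ ∑-* ws (𝟙 (t x)) _ ⟩
      𝟙 (t x) * degree x                                      ∎)
      where
      open ≤-Reasoning
      drop : ∀ b m → 𝟙 b * m ≤ m
      drop true  m = ≤-reflexive (+-identityʳ m)
      drop false m = z≤n

    #hit≤ : ∀ L → #hit L ≤ ∣X∣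
    #hit≤ L = ≤-trans (∑-mono xs (λ x → 𝟙-mono {hit L x} {true} (λ _ → refl)))
                      (≤-reflexive (trans (∑-const xs 1) (*-identityʳ _)))

  module _ (M B : ℕ) (0<B : 0 < B) (0<∣X∣ : 0 < length xs)
           (t-degree : ∑ xs (λ x → 𝟙 (t x) * degree x) ≤ B) where

    private
      -- Each chosen `w` costs `B` and each hit point of `t` costs `∣W∣`; the total is charged to
      -- the hit points, each of which pays `M * B / ∣X∣`. As `#hit` never exceeds `∣X∣`, the total
      -- cost stays below `M * B` however long the search runs.
      Invariant : List W → Set
      Invariant L = ∣X∣ * (B * length L + ∣W∣ * #hit∩t L) ≤ M * B * #hit L

      -- Averaging over w: some w whose gain pays for its share of the budget
      -- for both the length of L and the number of hit points of t.
      goodChoice : ∀ L → 2 * (∣W∣ * ∣X∣) < M * unhitDegree L →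
                   ∃ λ w → w ∈ ws × ∣X∣ * (B + ∣W∣ * gain∩t L w) < M * B * gain L w
      goodChoice L lt = ∑-<⇒∃ ws _ _ (begin-strict
        ∑ ws (λ w → ∣X∣ * (B + ∣W∣ * gain∩t L w))
          ≡⟨ trans (∑-* ws ∣X∣ _) (cong (∣X∣ *_) (trans (∑-+ ws _ _) (cong₂ _+_ (∑-const ws B) (∑-* ws ∣W∣ _)))) ⟩
        ∣X∣ * (∣W∣ * B + ∣W∣ * ∑ ws (gain∩t L))
          ≤⟨ *-monoʳ-≤ ∣X∣ (+-monoʳ-≤ (∣W∣ * B) (*-monoʳ-≤ ∣W∣ (≤-trans (∑-gain∩t L) t-degree))) ⟩
        ∣X∣ * (∣W∣ * B + ∣W∣ * B)
          ≡⟨ arith ∣X∣ ∣W∣ B ⟩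
        2 * (∣W∣ * ∣X∣) * B
          <⟨ *-monoˡ-< B ⦃ >-nonZero 0<B ⦄ lt ⟩
        M * unhitDegree L * B
          ≡⟨ arith′ M (unhitDegree L) B ⟩
        M * B * unhitDegree L
          ≡⟨ cong (M * B *_) (∑-gain L) ⟨
        M * B * ∑ ws (gain L)
          ≡⟨ ∑-* ws (M * B) _ ⟨
        ∑ ws (λ w → M * B * gain L w) ∎)
        where
        open ≤-Reasoning
        arith : ∀ x w b → x * (w * b + w * b) ≡ 2 * (w * x) * b
        arith = solve-∀
        arith′ : ∀ m u b → m * u * b ≡ m * b * u
        arith′ = solve-∀

      Result : Set
      Result = ∃ λ L → All (_∈ ws) L × M * unhitDegree L ≤ 2 * (∣W∣ * ∣X∣)
                     × B * length L + ∣W∣ * #hit∩t L ≤ M * B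

      -- The strict inequality of `goodChoice` forces a positive gain, so `#hit` grows with every
      -- choice. It is bounded by `∣X∣`, hence the fuel cannot run out before the unhit degree is
      -- small.
      search : ∀ fuel L → All (_∈ ws) L → Invariant L → ∣X∣ ≤ #hit L + fuel → Result
      search fuel L L⊆ws inv enough with M * unhitDegree L ≤? 2 * (∣W∣ * ∣X∣)
      ... | yes done = L , L⊆ws , done , *-cancelˡ-≤ ∣X∣ ⦃ >-nonZero 0<∣X∣ ⦄ (begin
          ∣X∣ * (B * length L + ∣W∣ * #hit∩t L)  ≤⟨ inv ⟩
          M * B * #hit L                         ≤⟨ *-monoʳ-≤ (M * B) (#hit≤ L) ⟩
          M * B * ∣X∣                            ≡⟨ *-comm (M * B) ∣X∣ ⟩
          ∣X∣ * (M * B)                          ∎)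
        where open ≤-Reasoning
      ... | no ¬done with goodChoice L (≰⇒> ¬done)
      ...   | w , w∈ws , good = continue fuel enough
        where
        open ≤-Reasoning
        0<gain : 0 < gain L w
        0<gain = positive (gain L w) good
          where
          positive : ∀ {m} g → m < M * B * g → 0 < g
          positive {m} zero bad = ⊥-elim (n≮0 (subst (m <_) (*-zeroʳ (M * B)) bad))
          positive (suc _) _ = s≤s z≤n
        arith : ∀ x b l c e g → x * (b * suc l + c * (e + g)) ≡ x * (b * l + c * e) + x * (b + c * g)
        arith = solve-∀
        inv′ : Invariant (w ∷ L)
        inv′ = begin
          ∣X∣ * (B * suc (length L) + ∣W∣ * #hit∩t (w ∷ L))
            ≡⟨ cong (λ e → ∣X∣ * (B * suc (length L) + ∣W∣ * e)) (#hit∩t-∷ w L) ⟩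
          ∣X∣ * (B * suc (length L) + ∣W∣ * (#hit∩t L + gain∩t L w))
            ≡⟨ arith ∣X∣ B (length L) ∣W∣ _ _ ⟩
          ∣X∣ * (B * length L + ∣W∣ * #hit∩t L) + ∣X∣ * (B + ∣W∣ * gain∩t L w)
            ≤⟨ +-mono-≤ inv (<⇒≤ good) ⟩
          M * B * #hit L + M * B * gain L w
            ≡⟨ *-distribˡ-+ (M * B) _ _ ⟨
          M * B * (#hit L + gain L w)
            ≡⟨ cong (M * B *_) (#hit-∷ w L) ⟨
          M * B * #hit (w ∷ L) ∎
        progress : ∀ f → ∣X∣ ≤ #hit L + f → suc ∣X∣ ≤ #hit (w ∷ L) + f
        progress f enough = begin
          suc ∣X∣                     ≤⟨ s≤s enough ⟩
          suc (#hit L + f)            ≡⟨ +-suc (#hit L) f ⟨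
          #hit L + suc f              ≤⟨ +-monoʳ-≤ (#hit L) (+-monoˡ-≤ f 0<gain) ⟩
          #hit L + (gain L w + f)     ≡⟨ +-assoc (#hit L) _ f ⟨
          #hit L + gain L w + f       ≡⟨ cong (_+ f) (#hit-∷ w L) ⟨
          #hit (w ∷ L) + f            ∎
        continue : ∀ fuel → ∣X∣ ≤ #hit L + fuel → Result
        continue zero       enough = ⊥-elim (<-irrefl refl (≤-trans (progress 0 enough)
          (≤-trans (≤-reflexive (+-identityʳ _)) (#hit≤ (w ∷ L)))))
        continue (suc fuel) enough = search fuel (w ∷ L) (w∈ws ∷ L⊆ws) inv′
          (≤-pred (≤-trans (progress (suc fuel) enough) (≤-reflexive (+-suc _ fuel))))

    greedy : Result
    greedy = search ∣X∣ [] [] (≤-reflexive (trans (cong (∣X∣ *_) (trans (cong₂ _+_ (*-zeroʳ B)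
        (trans (cong (∣W∣ *_) (∑-zero xs)) (*-zeroʳ ∣W∣))) refl)) (trans (*-zeroʳ ∣X∣)
        (sym (trans (cong (M * B *_) (∑-zero xs)) (*-zeroʳ (M * B)))))))
      (m≤n+m ∣X∣ _)

-- Counting by enumeration

length-cartesianProductWith : ∀ (h : A → A′ → A″) xs ys →
                              length (cartesianProductWith h xs ys) ≡ length xs * length ys
length-cartesianProductWith h []       ys = refl
length-cartesianProductWith h (x ∷ xs) ys = trans (length-++ (map (h x) ys))
  (cong₂ _+_ (length-map (h x) ys) (length-cartesianProductWith h xs ys))

length-filter-∑ : ∀ (b : A → Bool) xs → length (filter (λ x → b x Bool.≟ true) xs) ≡ ∑ xs (𝟙 ∘ b)
length-filter-∑ b []       = refl
length-filter-∑ b (x ∷ xs) with b x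
... | true  = cong suc (length-filter-∑ b xs)
... | false = length-filter-∑ b xs

length-concatMap-≤ : ∀ (f : A → List A′) {c} → (∀ x → length (f x) ≤ c) →
                     ∀ xs → length (concatMap f xs) ≤ length xs * c
length-concatMap-≤ f f≤c []       = z≤n
length-concatMap-≤ f f≤c (x ∷ xs) = ≤-trans (≤-reflexive (length-++ (f x)))
  (+-mono-≤ (f≤c x) (length-concatMap-≤ f f≤c xs))

-- Each entry of `ys` uses up one occurrence in `xs`: deleting `y` from `xs` keeps the other entries
-- of `ys` inside, because they differ from `y`.
unique-length-≤ : ∀ (b : A → Bool) {ys} xs → AllPairs _≢_ ys → All (λ y → y ∈ xs × b y ≡ true) ys →
                  length ys ≤ ∑ xs (𝟙 ∘ b)
unique-length-≤ b {[]}     xs _           _ = z≤n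
unique-length-≤ b {y ∷ ys} xs (y∉ys ∷ ys!) ((y∈xs , by) ∷ ys⊆xs) with ∈-∃++ y∈xs
... | as , bs , refl = begin
  suc (length ys)                              ≤⟨ s≤s (unique-length-≤ b (as ++ bs) ys! (All.zipWith remove (y∉ys , ys⊆xs))) ⟩
  suc (∑ (as ++ bs) (𝟙 ∘ b))                   ≡⟨ cong suc (∑-++ as bs _) ⟩
  suc (∑ as (𝟙 ∘ b) + ∑ bs (𝟙 ∘ b))            ≡⟨ +-suc (∑ as (𝟙 ∘ b)) _ ⟨
  ∑ as (𝟙 ∘ b) + (1 + ∑ bs (𝟙 ∘ b))            ≡⟨ cong (λ z → ∑ as (𝟙 ∘ b) + (𝟙 z + ∑ bs (𝟙 ∘ b))) by ⟨
  ∑ as (𝟙 ∘ b) + (𝟙 (b y) + ∑ bs (𝟙 ∘ b))      ≡⟨ ∑-++ as (y ∷ bs) _ ⟨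
  ∑ (as ++ y ∷ bs) (𝟙 ∘ b)                     ∎
  where
  open ≤-Reasoning
  remove : ∀ {z} → y ≢ z × (z ∈ as ++ y ∷ bs × b z ≡ true) → z ∈ as ++ bs × b z ≡ true
  remove (y≢z , z∈ , bz) with ∈-++⁻ as z∈
  ... | inj₁ z∈as         = ∈-++⁺ˡ z∈as , bz
  ... | inj₂ (here z≡y)   = ⊥-elim (y≢z (sym z≡y))
  ... | inj₂ (there z∈bs) = ∈-++⁺ʳ as z∈bs , bz

length-allFin : ∀ m → length (allFin m) ≡ m
length-allFin m = length-tabulate {n = m} id

∑-tabulate : ∀ {m} (g : Fin m → A) (f : A → ℕ) → ∑ (tabulate g) f ≡ ∑ (allFin m) (f ∘ g)
∑-tabulate {m = zero}  g f = refl
∑-tabulate {m = suc m} g f = cong (f (g zero) +_)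
  (trans (∑-tabulate (g ∘ suc) f) (sym (∑-tabulate suc (f ∘ g))))

∑-allFin-≟ : ∀ {m} (F : Fin m → ℕ) d b → ∑ (allFin m) (λ c → F c * 𝟙 (does (d Fin.≟ c) ∧ b)) ≡ F d * 𝟙 b
∑-allFin-≟ {m = suc m} F zero b = trans (cong (F zero * 𝟙 b +_) (trans (∑-tabulate {m = m} suc _)
  (trans (∑-cong (allFin m) λ c → *-zeroʳ (F (suc c))) (∑-zero (allFin m))))) (+-identityʳ _)
∑-allFin-≟ {m = suc m} F (suc d) b = trans (cong₂ _+_ (*-zeroʳ (F zero)) (∑-tabulate {m = m} suc _))
  (∑-allFin-≟ (F ∘ suc) d b)

allVec : List A → ∀ m → List (Vec A m)
allVec xs zero    = [] ∷ []
allVec xs (suc m) = cartesianProductWith _∷_ xs (allVec xs m)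

length-allVec : ∀ (xs : List A) m → length (allVec xs m) ≡ length xs ^ m
length-allVec xs zero    = refl
length-allVec xs (suc m) = trans (length-cartesianProductWith _∷_ xs _)
  (cong (length xs *_) (length-allVec xs m))

∈-allVec : ∀ {m} {xs : List A} → (∀ x → x ∈ xs) → (v : Vec A m) → v ∈ allVec xs m
∈-allVec x∈xs []      = here refl
∈-allVec x∈xs (x ∷ v) = ∈-cartesianProductWith⁺ _∷_ (x∈xs x) (∈-allVec x∈xs v)

-- Overwriting coordinate `i` forgets its old entry, so every vector arises once for each possible
-- old entry.
∑-allVec-update : ∀ {m} (xs : List A) (i : Fin m) (g : Vec A m → ℕ) →
                  ∑ (allVec xs m) (λ v → ∑ xs (λ u → g (v [ i ]≔ u))) ≡ length xs * ∑ (allVec xs m) g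
∑-allVec-update {m = suc m} xs zero g =
  trans (∑-cartesianProductWith _∷_ xs (allVec xs m) _)
  (trans (∑-const xs _) (cong (length xs *_)
  (trans (∑-swap (allVec xs m) xs _) (sym (∑-cartesianProductWith _∷_ xs (allVec xs m) g)))))
∑-allVec-update {m = suc m} xs (suc i) g =
  trans (∑-cartesianProductWith _∷_ xs (allVec xs m) _)
  (trans (∑-cong xs λ x → ∑-allVec-update xs i (g ∘ (x ∷_)))
  (trans (∑-* xs (length xs) _) (cong (length xs *_) (sym (∑-cartesianProductWith _∷_ xs (allVec xs m) g)))))

listsUpTo : List A → ℕ → List (List A)
listsUpTo xs zero    = [] ∷ []
listsUpTo xs (suc m) = [] ∷ cartesianProductWith _∷_ xs (listsUpTo xs m)

∈-listsUpTo : ∀ {xs l : List A} m → All (_∈ xs) l → length l ≤ m → l ∈ listsUpTo xs m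
∈-listsUpTo zero    []           _         = here refl
∈-listsUpTo (suc m) []           _         = here refl
∈-listsUpTo (suc m) (x∈xs ∷ all) (s≤s l≤m) =
  there (∈-cartesianProductWith⁺ _∷_ x∈xs (∈-listsUpTo m all l≤m))

-- Padding with a blank turns such a list into a word of length exactly `m`; the `suc` accounts for
-- the blank.
length-listsUpTo-≤ : ∀ (xs : List A) m → length (listsUpTo xs m) ≤ suc (length xs) ^ m
length-listsUpTo-≤ xs zero    = ≤-refl
length-listsUpTo-≤ xs (suc m) = +-mono-≤ (m^n>0 (suc (length xs)) m)
  (≤-trans (≤-reflexive (length-cartesianProductWith _∷_ xs _))
           (*-monoʳ-≤ (length xs) (length-listsUpTo-≤ xs m)))

all-cong : ∀ {f g : A → Bool} {xs} → All (λ x → f x ≡ g x) xs → all f xs ≡ all g xs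
all-cong []         = refl
all-cong (eq ∷ eqs) = cong₂ _∧_ eq (all-cong eqs)

all-∧ : ∀ (f g : A → Bool) xs → all (λ x → f x ∧ g x) xs ≡ all f xs ∧ all g xs
all-∧ f g []       = refl
all-∧ f g (x ∷ xs) = trans (cong ((f x ∧ g x) ∧_) (all-∧ f g xs)) (shuffle (f x) (g x) _ _)
  where
  shuffle : ∀ a b c d → (a ∧ b) ∧ (c ∧ d) ≡ (a ∧ c) ∧ (b ∧ d)
  shuffle true  true  c d = refl
  shuffle true  false true  d = refl
  shuffle true  false false d = refl
  shuffle false b     c d = refl

any-cong : ∀ {f : A → Bool} {g : A′ → Bool} (h : A → A′) → (∀ x → g (h x) ≡ f x) →
           ∀ xs → any g (map h xs) ≡ any f xs
any-cong h eq []       = refl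
any-cong h eq (x ∷ xs) = cong₂ _∨_ (eq x) (any-cong h eq xs)

-- Placements of `K_N` and the points they hit

Edge : ℕ → Set
Edge N = Fin N × Fin N

-- A full colour matrix with an arbitrary map of vertices. Embeddings and members of the family are
-- singled out later by `valid`; admitting all maps makes the count under moving two vertices exact.
Placement : ℕ → ℕ → ℕ → Set
Placement n k N = Vec (Vec (Fin k) N) N × Vec (Fin n) N

Point : ℕ → ℕ → Set
Point n k = Fin n × Fin n × Fin k

_⊆ᵇ_ : ∀ {A : Set} → (A → Bool) → (A → Bool) → Set
S ⊆ᵇ T = ∀ x → S x ≡ true → T x ≡ true

∧-true⁻ : ∀ {a b} → a ∧ b ≡ true → a ≡ true × b ≡ true
∧-true⁻ {true} b≡true = refl , b≡true

∧-true⁺ : ∀ {a b} → a ≡ true → b ≡ true → a ∧ b ≡ true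
∧-true⁺ refl b≡true = b≡true

NonLoop : ∀ {N} → Edge N → Set
NonLoop (a , b) = a ≢ b

_avoids_ : ∀ {N} → Edge N → Fin N → Set
(a , b) avoids i = a ≢ i × b ≢ i

-- Says that `e` misses an end of `(a , b)`, so that once the ends of `(a , b)` are moved to `u` and
-- `v`, the position of `e` depends on at most one of `u` and `v`.
NotParallel : ∀ {N} → Edge N → Edge N → Set
NotParallel (a , b) e = e avoids b ⊎ e avoids a

module Copies {n k N : ℕ} (valid : Placement n k N → Bool) where

  X = Point n k
  W = Placement n k N

  points : List X
  points = cartesianProduct (allFin n) (cartesianProduct (allFin n) (allFin k))

  placements : List W
  placements = cartesianProduct (allVec (allVec (allFin k) N) N) (allVec (allFin n) N)

  ∈-points : ∀ x → x ∈ points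
  ∈-points (u , v , c) = ∈-cartesianProduct⁺ (∈-allFin u) (∈-cartesianProduct⁺ (∈-allFin v) (∈-allFin c))

  ∈-placements : ∀ w → w ∈ placements
  ∈-placements (f , φ) = ∈-cartesianProduct⁺ (∈-allVec (∈-allVec ∈-allFin) f) (∈-allVec ∈-allFin φ)

  length-points : length points ≡ n * (n * k)
  length-points = trans (length-cartesianProductWith _,_ (allFin n) _) (cong₂ _*_ (length-allFin n)
    (trans (length-cartesianProductWith _,_ (allFin n) (allFin k)) (cong₂ _*_ (length-allFin n) (length-allFin k))))

  length-placements : length placements ≡ (k ^ N) ^ N * n ^ N
  length-placements = trans (length-cartesianProductWith _,_ (allVec (allVec (allFin k) N) N) _) (cong₂ _*_
    (trans (length-allVec (allVec (allFin k) N) N) (cong (_^ N) (trans (length-allVec (allFin k) N) (cong (_^ N) (length-allFin k)))))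
    (trans (length-allVec (allFin n) N) (cong (_^ N) (length-allFin n))))

  _≟ˣ_ : DecidableEquality X
  _≟ˣ_ = ≡-dec Fin._≟_ (≡-dec Fin._≟_ Fin._≟_)

  open DecMembership _≟ˣ_ using (_∈?_)

  colour : Vec (Vec (Fin k) N) N → Edge N → Fin k
  colour f (a , b) = lookup (lookup f a) b

  pointAt : Edge N → W → X
  pointAt (a , b) (f , φ) = lookup φ a , lookup φ b , colour f (a , b)

  within : (X → Bool) → List (Edge N) → W → Bool
  within T es w = all (λ e → T (pointAt e w)) es

  copy : (T t : X → Bool) (done todo : List (Edge N)) → W → Bool
  copy T t done todo w = valid w ∧ (within T done w ∧ within t todo w)

  place : Edge N → Fin n → Fin n → W → W
  place (a , b) u v (f , φ) = f , (φ [ a ]≔ u) [ b ]≔ v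

  -- The positions that `w` gives to the ends of `e` are overwritten, so a single placement hits
  -- every point that completes its remaining vertices. This is how few placements can hit many
  -- points.
  extends : Edge N → (W → Bool) → X → W → Bool
  extends e q (u , v , c) w = does (colour (proj₁ w) e Fin.≟ c) ∧ q (place e u v w)

  -- Double counting. For fixed `w` the colour test leaves one colour per pair `(u , v)`, and
  -- forgetting the two old positions gives the factor `n * n`. It is used with `h` the indicator of
  -- `t` and with `h` the indicator of the unhit points.
  ∑-extends : ∀ e → NonLoop e → (q : W → Bool) (h : X → ℕ) →
              ∑ points (λ x → h x * ∑ placements (λ w → 𝟙 (extends e q x w)))
              ≡ n * (n * ∑ placements (λ w → h (pointAt e w) * 𝟙 (q w)))
  ∑-extends e@(a , b) a≢b q h = begin
    ∑ points (λ x → h x * ∑ placements (λ w → 𝟙 (extends e q x w)))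
      ≡⟨ ∑-cong points (λ x → ∑-* placements (h x) _) ⟨
    ∑ points (λ x → ∑ placements (λ w → h x * 𝟙 (extends e q x w)))
      ≡⟨ ∑-swap points placements _ ⟩
    ∑ placements (λ w → ∑ points (λ x → h x * 𝟙 (extends e q x w)))
      ≡⟨ ∑-cong placements (λ w → collapse w) ⟩
    ∑ placements (λ w → ∑ (allFin n) λ u → ∑ (allFin n) λ v → g (place e u v w))
      ≡⟨ ∑-cartesianProductWith _,_ colours (allVec (allFin n) N) _ ⟩
    ∑ colours (λ f → ∑ (allVec (allFin n) N) λ φ → ∑ (allFin n) λ u → ∑ (allFin n) λ v → g (f , (φ [ a ]≔ u) [ b ]≔ v))
      ≡⟨ ∑-cong colours (λ f → trans (∑-allVec-update (allFin n) a _)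
           (cong₂ _*_ (length-allFin n) (trans (∑-allVec-update (allFin n) b _) (cong (_* ∑ (allVec (allFin n) N) (g ∘ (f ,_))) (length-allFin n))))) ⟩
    ∑ colours (λ f → n * (n * ∑ (allVec (allFin n) N) (g ∘ (f ,_))))
      ≡⟨ trans (∑-* colours n _) (cong (n *_) (∑-* colours n _)) ⟩
    n * (n * ∑ colours (λ f → ∑ (allVec (allFin n) N) (g ∘ (f ,_))))
      ≡⟨ cong (λ s → n * (n * s)) (∑-cartesianProductWith _,_ colours (allVec (allFin n) N) g) ⟨
    n * (n * ∑ placements g) ∎
    where
    open ≡-Reasoning
    colours = allVec (allVec (allFin k) N) N
    g : W → ℕ
    g w = h (pointAt e w) * 𝟙 (q w)
    pointAt-place : ∀ u v w → pointAt e (place e u v w) ≡ (u , v , colour (proj₁ w) e)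
    pointAt-place u v (f , φ) = cong₂ (λ x y → x , y , colour f e)
      (trans (lookup∘update′ a≢b (φ [ a ]≔ u) v) (lookup∘update a φ u)) (lookup∘update b (φ [ a ]≔ u) v)
    collapse : ∀ w → ∑ points (λ x → h x * 𝟙 (extends e q x w))
                   ≡ ∑ (allFin n) λ u → ∑ (allFin n) λ v → g (place e u v w)
    collapse w = trans (∑-cartesianProductWith _,_ (allFin n) _ _) (∑-cong (allFin n) λ u →
      trans (∑-cartesianProductWith _,_ (allFin n) (allFin k) _) (∑-cong (allFin n) λ v →
      trans (∑-allFin-≟ (λ c → h (u , v , c)) (colour (proj₁ w) e) (q (place e u v w)))
            (cong (λ x → h x * 𝟙 (q (place e u v w))) (sym (pointAt-place u v w)))))

  -- What a chosen placement records of the template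

  touches : Fin N → Edge N → Bool
  touches i (a , b) = does (a Fin.≟ i) ∨ does (b Fin.≟ i)

  -- The two vectors hold one bit per vertex of `K_n` for either end of the current edge: linearly
  -- many bits in `n`, whereas the whole of `t` has quadratically many.
  Letter : Set
  Letter = W × Vec Bool n × Vec Bool n

  letters : List Letter
  letters = cartesianProduct placements (cartesianProduct bits bits)
    where bits = allVec (true ∷ false ∷ []) n

  ∈-letters : ∀ l → l ∈ letters
  ∈-letters (w , p , q) = ∈-cartesianProduct⁺ (∈-placements w)
    (∈-cartesianProduct⁺ (∈-allVec ∈-Bool p) (∈-allVec ∈-Bool q))
    where
    ∈-Bool : ∀ b → b ∈ true ∷ false ∷ []
    ∈-Bool true  = here refl
    ∈-Bool false = there (here refl)

  length-letters : length letters ≡ (k ^ N) ^ N * n ^ N * (2 ^ n * 2 ^ n)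
  length-letters = trans (length-cartesianProductWith _,_ placements _) (cong₂ _*_ length-placements
    (trans (length-cartesianProductWith _,_ (allVec (true ∷ false ∷ []) n) _)
      (cong₂ _*_ (length-allVec (true ∷ false ∷ []) n) (length-allVec (true ∷ false ∷ []) n))))

  -- Once w is fixed, no edge of todo joins both moved vertices, so whether the edges of
  -- todo lie in t is a conjunction of a condition on u and a condition on v.
  letter : (X → Bool) → Edge N → List (Edge N) → W → Letter
  letter t (a , b) todo w@(f , φ) = w ,
    Vec.tabulate (λ u → all (λ e → touches b e ∨ t (pointAt e (f , φ [ a ]≔ u))) todo) ,
    Vec.tabulate (λ v → all (λ e → not (touches b e) ∨ t (pointAt e (f , φ [ b ]≔ v))) todo)

  -- The decoder: it recovers the hit relation from `T` and a letter alone, with no access to `t`.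
  -- Hence a container depends on `t` only through fingerprints.
  hitBy : (X → Bool) → List (Edge N) → Edge N → X → Letter → Bool
  hitBy T done e x@(u , v , c) (w , p , q) =
    extends e (λ w′ → valid w′ ∧ (within T done w′ ∧ (lookup p u ∧ lookup q v))) x w

  hitBy-letter : ∀ T t done e todo → All (NotParallel e) todo →
                 ∀ x w → hitBy T done e x (letter t e todo w) ≡ extends e (copy T t done todo) x w
  hitBy-letter T t done (a , b) todo np (u , v , c) w@(f , φ) =
    cong (λ z → does (colour f (a , b) Fin.≟ c) ∧ (valid w′ ∧ (within T done w′ ∧ z)))
    (trans (cong₂ _∧_ (lookup∘tabulate _ u) (lookup∘tabulate _ v))
    (trans (sym (all-∧ _ _ todo)) (all-cong (All.map pointwise np))))
    where
    w′ = place (a , b) u v w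
    same : ∀ {i} → i ≢ a → lookup (φ [ b ]≔ v) i ≡ lookup ((φ [ a ]≔ u) [ b ]≔ v) i
    same {i} i≢a with i Fin.≟ b
    ... | yes refl = trans (lookup∘update b φ v) (sym (lookup∘update b (φ [ a ]≔ u) v))
    ... | no  i≢b  = trans (lookup∘update′ i≢b φ v) (trans (sym (lookup∘update′ i≢a φ u)) (sym (lookup∘update′ i≢b (φ [ a ]≔ u) v)))
    pointwise : ∀ {e} → NotParallel (a , b) e →
      (touches b e ∨ t (pointAt e (f , φ [ a ]≔ u))) ∧ (not (touches b e) ∨ t (pointAt e (f , φ [ b ]≔ v)))
      ≡ t (pointAt e w′)
    pointwise {e@(a′ , b′)} np with a′ Fin.≟ b | b′ Fin.≟ b | np
    ... | no a′≢b  | no b′≢b | _ = trans (∧-comm _ true) (cong t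
      (cong₂ (λ x y → x , y , colour f e) (sym (lookup∘update′ a′≢b (φ [ a ]≔ u) v)) (sym (lookup∘update′ b′≢b (φ [ a ]≔ u) v))))
    ... | yes a′≡b | _       | inj₁ (a′≢b , _) = ⊥-elim (a′≢b a′≡b)
    ... | _        | yes b′≡b | inj₁ (_ , b′≢b) = ⊥-elim (b′≢b b′≡b)
    ... | yes refl | _       | inj₂ (a′≢a , b′≢a) = cong t (cong₂ (λ x y → x , y , colour f e) (same a′≢a) (same b′≢a))
    ... | no _     | yes refl | inj₂ (a′≢a , b′≢a) = cong t (cong₂ (λ x y → x , y , colour f e) (same a′≢a) (same b′≢a))

  -- Processing one edge

  Fingerprint : Set
  Fingerprint = List Letter × List X

  shrink : (X → Bool) → List (Edge N) → Edge N → Fingerprint → X → Bool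
  shrink T done e (ls , exc) x = T x ∧ (not (any (hitBy T done e x) ls) ∨ does (x ∈? exc))

  #copies : (T t : X → Bool) (done todo : List (Edge N)) → ℕ
  #copies T t done todo = ∑ placements λ w → 𝟙 (copy T t done todo w)

  within-mono : ∀ {S T} → S ⊆ᵇ T → ∀ es w → within S es w ≡ true → within T es w ≡ true
  within-mono S⊆T []       w p = refl
  within-mono S⊆T (e ∷ es) w p = ∧-true⁺ (S⊆T _ (proj₁ (∧-true⁻ p))) (within-mono S⊆T es w (proj₂ (∧-true⁻ p)))

  -- `B` bounds `n * n` times the number of copies before the step. Exceptions number at most
  -- `M * B` divided by the number of placements, and the bound `B` grows by the degree left unhit,
  -- which is of order `1 / M`: a large `M` buys few new copies at the price of a longer
  -- fingerprint.
  record Shrunk (T t : X → Bool) (done : List (Edge N)) (e : Edge N) (todo : List (Edge N)) (M B : ℕ) : Set where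
    field
      fingerprint  : Fingerprint
      few-letters  : length (proj₁ fingerprint) ≤ M
      few-exceptions : length placements * length (proj₂ fingerprint) ≤ M * B
      t-inside     : t ⊆ᵇ shrink T done e fingerprint
      excess       : ℕ
      small-excess : M * excess ≤ 2 * (length placements * length points)
      few-copies   : n * (n * #copies (shrink T done e fingerprint) t (e ∷ done) todo) ≤ B + excess

  -- In the greedy relation `e` is free, so by `∑-extends` the degree carried by `t` is `n * n`
  -- times the number of copies with `e` placed in `t`. That is exactly what `few` bounds.
  shrink-step : ∀ T t done e todo M B → NonLoop e → All (NotParallel e) todo → 0 < length points → 0 < B →
                t ⊆ᵇ T → n * (n * #copies T t done (e ∷ todo)) ≤ B → Shrunk T t done e todo M B
  shrink-step T t done e todo M B loopless np 0<X 0<B t⊆T few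
    with Greedy.greedy points placements (extends e (copy T t done todo)) t M B 0<B 0<X
           (≤-trans (≤-reflexive (trans (∑-extends e loopless (copy T t done todo) (𝟙 ∘ t))
             (cong (λ s → n * (n * s)) (∑-cong placements λ w → 𝟙-shuffle (t (pointAt e w)) (valid w) (within T done w) (within t todo w))))) few)
    where
    𝟙-shuffle : ∀ a v p q → 𝟙 a * 𝟙 (v ∧ (p ∧ q)) ≡ 𝟙 (v ∧ (p ∧ (a ∧ q)))
    𝟙-shuffle true  v     p     q = +-identityʳ _
    𝟙-shuffle false true  true  q = refl
    𝟙-shuffle false true  false q = refl
    𝟙-shuffle false false p     q = refl
  ... | L , _ , small , budget = record
    { fingerprint    = fp
    ; few-letters    = ≤-trans (≤-reflexive (length-map (letter t e todo) L)) (*-cancelˡ-≤ B ⦃ >-nonZero 0<B ⦄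
                         (≤-trans (m≤m+n _ _) (≤-trans budget (≤-reflexive (*-comm M B)))))
    ; few-exceptions = ≤-trans (≤-reflexive (cong (length placements *_) (length-filter-∑ exceptional points)))
                         (≤-trans (m≤n+m _ _) budget)
    ; t-inside       = t-inside
    ; excess         = unhitDegree L
    ; small-excess   = small
    ; few-copies     = begin
        n * (n * #copies T′ t (e ∷ done) todo)
          ≤⟨ *-monoʳ-≤ n (*-monoʳ-≤ n (∑-mono placements split)) ⟩
        n * (n * ∑ placements (λ w → 𝟙 (copy T t done (e ∷ todo) w) + 𝟙 (not (hit L (pointAt e w))) * 𝟙 (copy T t done todo w)))
          ≡⟨ cong (λ s → n * (n * s)) (∑-+ placements _ _) ⟩
        n * (n * (#copies T t done (e ∷ todo) + new))
          ≡⟨ distrib n _ new ⟩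
        n * (n * #copies T t done (e ∷ todo)) + n * (n * new)
          ≤⟨ +-monoˡ-≤ _ few ⟩
        B + n * (n * new)
          ≡⟨ cong (B +_) (∑-extends e loopless (copy T t done todo) (λ x → 𝟙 (not (hit L x)))) ⟨
        B + unhitDegree L ∎
    }
    where
    open ≤-Reasoning
    open Greedy points placements (extends e (copy T t done todo)) t
    new : ℕ
    new = ∑ placements λ w → 𝟙 (not (hit L (pointAt e w))) * 𝟙 (copy T t done todo w)
    distrib : ∀ n a b → n * (n * (a + b)) ≡ n * (n * a) + n * (n * b)
    distrib = solve-∀
    exceptional : X → Bool
    exceptional x = hit L x ∧ t x
    fp : Fingerprint
    fp = map (letter t e todo) L , filter (λ x → exceptional x Bool.≟ true) points
    T′ = shrink T done e fp
    hit-decoded : ∀ x → any (hitBy T done e x) (proj₁ fp) ≡ hit L x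
    hit-decoded x = any-cong (letter t e todo) (hitBy-letter T t done e todo np x) L
    T′⊆T : T′ ⊆ᵇ T
    T′⊆T x = proj₁ ∘ ∧-true⁻
    T′-cases : ∀ x → T′ x ≡ true → hit L x ≡ false ⊎ t x ≡ true
    T′-cases x T′x with hit L x in eq | x ∈? proj₂ fp | proj₂ (∧-true⁻ {T x} T′x)
    ... | false | _       | _ = inj₁ refl
    ... | true  | yes x∈exc | _ = inj₂ (proj₂ (∧-true⁻ {hit L x} (proj₂ (∈-filter⁻ (λ x → exceptional x Bool.≟ true) {xs = points} x∈exc))))
    ... | true  | no _    | r with any (hitBy T done e x) (proj₁ fp) | trans (hit-decoded x) eq
    ...   | .true | refl with () ← r
    t-inside : t ⊆ᵇ T′
    t-inside x tx = ∧-true⁺ (t⊆T x tx) (helper (hit L x) refl)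
      where
      helper : ∀ h → hit L x ≡ h → not (any (hitBy T done e x) (proj₁ fp)) ∨ does (x ∈? proj₂ fp) ≡ true
      helper false eq rewrite trans (hit-decoded x) eq = refl
      helper true  eq rewrite trans (hit-decoded x) eq =
        dec-true (x ∈? proj₂ fp) (∈-filter⁺ (λ x → exceptional x Bool.≟ true) (∈-points x) (∧-true⁺ eq tx))
    -- A point surviving in `T′` is in `t` or unhit. In the first case the copy was already counted
    -- with `e` unprocessed; in the second it contributes to the unhit degree.
    split : ∀ w → 𝟙 (copy T′ t (e ∷ done) todo w)
                ≤ 𝟙 (copy T t done (e ∷ todo) w) + 𝟙 (not (hit L (pointAt e w))) * 𝟙 (copy T t done todo w)
    split w with copy T′ t (e ∷ done) todo w in isCopy
    ... | false = z≤n
    ... | true with ∧-true⁻ {valid w} isCopy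
    ...   | vw , rest with ∧-true⁻ {within T′ (e ∷ done) w} rest
    ...     | inT′ , int with ∧-true⁻ {T′ (pointAt e w)} inT′
    ...       | T′e , inT′done with within-mono T′⊆T done w inT′done | T′-cases (pointAt e w) T′e
    ...         | inT | inj₁ unhit rewrite vw | inT | int | unhit = m≤n+m 1 _
    ...         | inT | inj₂ te    rewrite vw | inT | int | te    = s≤s z≤n

-- The tree of containers

module Containers {n k N : ℕ} (valid : Placement n k N → Bool) (maxLetters maxExceptions : ℕ) where
  open Copies valid

  fingerprints : List Fingerprint
  fingerprints = cartesianProduct (listsUpTo letters maxLetters) (listsUpTo points maxExceptions)

  -- Branches over all candidate fingerprints, whether or not a template produces them; this makes
  -- the tree independent of `t`. Unsuitable leaves are filtered out afterwards.
  containers : (done todo : List (Edge N)) → (X → Bool) → List (X → Bool)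
  containers done []         T = T ∷ []
  containers done (e ∷ todo) T = concatMap (λ fp → containers (e ∷ done) todo (shrink T done e fp)) fingerprints

  length-containers-≤ : ∀ done todo T → length (containers done todo T) ≤ length fingerprints ^ length todo
  length-containers-≤ done []         T = ≤-refl
  length-containers-≤ done (e ∷ todo) T =
    length-concatMap-≤ _ (λ fp → length-containers-≤ (e ∷ done) todo _) fingerprints

  module _ (E c̄ : ℕ) (1≤E : 1 ≤ E) (0<X : 0 < length points) (0<W : 0 < length placements)
           (exceptions-fit : ∀ x → E ^ 5 * x ≤ c̄ * length points → x ≤ maxExceptions) where

    private
      WX = length placements * length points

    -- Processing an edge lowers M by a factor E ^ 5, which is what keeps the exceptions rare.
    container-exists : ∀ done todo T t B c → All NonLoop todo → AllPairs NotParallel todo →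
      t ⊆ᵇ T → 0 < B → n * (n * #copies T t done todo) ≤ B →
      E ^ (length todo * 5 + 1) ≤ maxLetters →
      E ^ (length todo * 5 + 1) * B ≤ c * WX → c + 2 * length todo ≤ c̄ →
      ∃ λ T′ → T′ ∈ containers done todo T × t ⊆ᵇ T′
             × E * (n * (n * #copies T′ t (todo ʳ++ done) [])) ≤ c̄ * WX
    -- At a leaf the parameter has come down to `E ^ 1`, which is the factor `E` saved in the final
    -- count of copies.
    container-exists done [] T t B c _ _ t⊆T 0<B few fits MB≤ c≤c̄ = T , here refl , t⊆T , (begin
      E * (n * (n * #copies T t done []))  ≤⟨ *-monoʳ-≤ E few ⟩
      E * B                                ≡⟨ cong (_* B) (^-identityʳ E) ⟨
      E ^ 1 * B                            ≤⟨ MB≤ ⟩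
      c * WX                               ≤⟨ *-monoˡ-≤ WX (≤-trans (≤-reflexive (sym (+-identityʳ c))) c≤c̄) ⟩
      c̄ * WX                               ∎)
      where open ≤-Reasoning
    container-exists done (e ∷ todo) T t B c (loopless ∷ nls) (np ∷ nps) t⊆T 0<B few fits MB≤ c≤c̄ =
      T″ , ∈-concatMap⁺ (λ fp → containers (e ∷ done) todo (shrink T done e fp)) (lose fp∈ T″∈) , t⊆T″ , bound
      where
      open ≤-Reasoning
      s = length todo
      M = E ^ (s * 5 + 1)
      open Shrunk (shrink-step T t done e todo M B loopless np 0<X 0<B t⊆T few)
      E⁵M : E ^ (suc s * 5 + 1) ≡ E ^ 5 * M
      E⁵M = ^-distribˡ-+-* E 5 (s * 5 + 1)
      M≤ : M ≤ E ^ (suc s * 5 + 1)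
      M≤ = ^-monoʳ-≤ E ⦃ >-nonZero 1≤E ⦄ (m≤n+m (s * 5 + 1) 5)
      exc = length (proj₂ fingerprint)
      exc≤ : exc ≤ maxExceptions
      -- Multiplying by `E ^ 5` turns `M` back into the parameter of the level above, at which the
      -- product with `B` is controlled by `MB≤`.
      exc≤ = exceptions-fit exc (*-cancelˡ-≤ (length placements) ⦃ >-nonZero 0<W ⦄ (begin
        length placements * (E ^ 5 * exc)    ≡⟨ swap (length placements) (E ^ 5) exc ⟩
        E ^ 5 * (length placements * exc)    ≤⟨ *-monoʳ-≤ (E ^ 5) few-exceptions ⟩
        E ^ 5 * (M * B)                      ≡⟨ *-assoc (E ^ 5) M B ⟨
        E ^ 5 * M * B                        ≡⟨ cong (_* B) E⁵M ⟨
        E ^ (suc s * 5 + 1) * B              ≤⟨ MB≤ ⟩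
        c * WX                               ≤⟨ *-monoˡ-≤ WX (≤-trans (m≤m+n c _) c≤c̄) ⟩
        c̄ * WX                               ≡⟨ swap c̄ (length placements) (length points) ⟩
        length placements * (c̄ * length points) ∎))
        where
        swap : ∀ a b c → a * (b * c) ≡ b * (a * c)
        swap = solve-∀
      fp∈ : fingerprint ∈ fingerprints
      fp∈ = ∈-cartesianProduct⁺
        (∈-listsUpTo maxLetters (All.tabulate (λ {l} _ → ∈-letters l)) (≤-trans few-letters (≤-trans M≤ fits)))
        (∈-listsUpTo maxExceptions (All.tabulate (λ {x} _ → ∈-points x)) exc≤)
      -- `c` grows by 2 per edge: `M * B` still fits under the old `c * WX`, and `M * excess` adds
      -- at most `2 * WX`.
      rec = container-exists (e ∷ done) todo (shrink T done e fingerprint) t (B + excess) (c + 2)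
        nls nps t-inside (≤-trans 0<B (m≤m+n B excess)) few-copies (≤-trans M≤ fits) (begin
          M * (B + excess)                   ≡⟨ *-distribˡ-+ M B excess ⟩
          M * B + M * excess                 ≤⟨ +-mono-≤ (≤-trans (*-monoˡ-≤ B M≤) MB≤) small-excess ⟩
          c * WX + 2 * WX                    ≡⟨ *-distribʳ-+ WX c 2 ⟨
          (c + 2) * WX                       ∎)
        (≤-trans (≤-reflexive (shift c s)) c≤c̄)
        where
        shift : ∀ c s → c + 2 + 2 * s ≡ c + 2 * suc s
        shift = solve-∀
      T″ = proj₁ rec
      T″∈ = proj₁ (proj₂ rec)
      t⊆T″ = proj₁ (proj₂ (proj₂ rec))
      bound = proj₂ (proj₂ (proj₂ rec))

-- The edges of `K_N`

edges : ∀ N → List (Edge N)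
edges zero    = []
edges (suc N) = map (λ j → zero , suc j) (allFin N) ++ map (Product.map suc suc) (edges N)

length-edges : ∀ N → length (edges N) ≡ N C 2
length-edges zero    = refl
length-edges (suc N) = begin
  length (edges (suc N))                             ≡⟨ length-++ (map (λ j → zero , suc j) (allFin N)) ⟩
  length (map (λ j → zero , suc j) (allFin N)) + length (map (Product.map suc suc) (edges N))
    ≡⟨ cong₂ _+_ (trans (length-map (λ j → zero , suc j) (allFin N)) (length-allFin N))
                 (trans (length-map (Product.map suc suc) (edges N)) (length-edges N)) ⟩
  N + N C 2                                          ≡⟨ cong (_+ N C 2) (nC1≡n N) ⟨
  N C 1 + N C 2                                      ≡⟨ nCk+nC[k+1]≡[n+1]C[k+1] N 1 ⟩
  suc N C 2                                          ∎
  where open ≡-Reasoning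

Increasing : ∀ {N} → Edge N → Set
Increasing (a , b) = a Fin.< b

edges-increasing : ∀ N → All Increasing (edges N)
edges-increasing zero    = []
edges-increasing (suc N) = Allₚ.++⁺ (Allₚ.map⁺ (All.tabulate λ _ → s≤s z≤n))
                                    (Allₚ.map⁺ (All.map s≤s (edges-increasing N)))

edges-complete : ∀ {N} (i j : Fin N) → i Fin.< j → (i , j) ∈ edges N
edges-complete zero    (suc j) _         = ∈-++⁺ˡ (∈-map⁺ _ (∈-allFin j))
edges-complete (suc i) (suc j) (s≤s i<j) = ∈-++⁺ʳ _ (∈-map⁺ _ (edges-complete i j i<j))

-- Two edges of the star at `zero` differ in their other end, and all edges listed after the star
-- avoid `zero`.
edges-notParallel : ∀ N → AllPairs NotParallel (edges N)
edges-notParallel zero    = []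
edges-notParallel (suc N) = AllPairsₚ.++⁺
  (AllPairsₚ.map⁺ (AllPairsₚ.tabulate⁺ λ i≢j → inj₁ ((λ ()) , i≢j ∘ sym ∘ Finₚ.suc-injective)))
  (AllPairsₚ.map⁺ (AllPairs.map lift (edges-notParallel N)))
  (Allₚ.map⁺ (All.tabulate λ _ → Allₚ.map⁺ (All.tabulate λ _ → inj₂ ((λ ()) , (λ ())))))
  where
  lift : ∀ {e f : Edge N} → NotParallel e f → NotParallel (Product.map suc suc e) (Product.map suc suc f)
  lift (inj₁ (p , q)) = inj₁ (p ∘ Finₚ.suc-injective , q ∘ Finₚ.suc-injective)
  lift (inj₂ (p , q)) = inj₂ (p ∘ Finₚ.suc-injective , q ∘ Finₚ.suc-injective)

-- Numerical estimates

root : ∀ p → 0 < p → ∀ n → ∃ λ E → E ^ p ≤ n × n < suc E ^ p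
root (suc p) _ zero = 0 , z≤n , m^n>0 1 (suc p)
root p 0<p (suc n) with root p 0<p n
... | E , E^p≤n , n<[1+E]^p with suc E ^ p ≤? suc n
-- The root rises by at most one, since `suc n` is still below the next power.
...   | yes next = suc E , next , ≤-<-trans n<[1+E]^p (^-monoˡ-< p ⦃ >-nonZero 0<p ⦄ (n<1+n (suc E)))
...   | no  ¬next = E , m≤n⇒m≤1+n E^p≤n , ≰⇒> ¬next

^-cancelˡ-≤ : ∀ m {x y} → 0 < m → x ^ m ≤ y ^ m → x ≤ y
^-cancelˡ-≤ m {x} {y} 0<m le with x ≤? y
... | yes x≤y = x≤y
... | no  x≰y = ⊥-elim (<⇒≱ (^-monoˡ-< m ⦃ >-nonZero 0<m ⦄ (≰⇒> x≰y)) le)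

^-distribʳ-* : ∀ m x y → (x * y) ^ m ≡ x ^ m * y ^ m
^-distribʳ-* zero    x y = refl
^-distribʳ-* (suc m) x y = trans (cong (x * y *_) (^-distribʳ-* m x y)) (shuffle x y _ _)
  where
  shuffle : ∀ a b c d → a * b * (c * d) ≡ a * c * (b * d)
  shuffle = solve-∀

n<2^n : ∀ n → n < 2 ^ n
n<2^n zero    = s≤s z≤n
n<2^n (suc n) = begin-strict
  suc n           ≤⟨ n<2^n n ⟩
  2 ^ n           <⟨ m<m+n (2 ^ n) (≤-trans (m^n>0 2 n) (m≤m+n (2 ^ n) 0)) ⟩
  2 ^ suc n       ∎
  where open ≤-Reasoning

1+n≤2^1+m : ∀ {n} m → n ≤ 2 ^ m → suc n ≤ 2 ^ suc m
1+n≤2^1+m m n≤ = +-mono-≤ (m^n>0 2 m) (≤-trans n≤ (m≤m+n (2 ^ m) 0))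

-- `(N + j) !` is `j !` times `N` factors that are all at least `j`.
^-lower-binomial : ∀ N j → j ^ N ≤ N ! * ((N + j) C N)
^-lower-binomial N j = *-cancelʳ-≤ (j ^ N) (N ! * ((N + j) C N)) (j !) ⦃ j !≢0 ⦄ (begin
  j ^ N * j !                     ≤⟨ factorial N ⟩
  (N + j) !                       ≡⟨ m/n*n≡m (k![n∸k]!∣n! N≤N+j) ⟨
  ((N + j) ! / d) * d             ≡⟨ cong (_* d) (nCk≡n!/k![n-k]! N≤N+j) ⟨
  ((N + j) C N) * d               ≡⟨ cong (λ i → ((N + j) C N) * (N ! * i !)) (m+n∸m≡n N j) ⟩
  ((N + j) C N) * (N ! * j !)     ≡⟨ shuffle ((N + j) C N) (N !) (j !) ⟩
  N ! * ((N + j) C N) * j !       ∎)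
  where
  open ≤-Reasoning
  N≤N+j : N ≤ N + j
  N≤N+j = m≤m+n N j
  d = N ! * (N + j ∸ N) !
  instance _ = N !* (N + j ∸ N) !≢0
  shuffle : ∀ a b c → a * (b * c) ≡ b * a * c
  shuffle = solve-∀
  factorial : ∀ N → j ^ N * j ! ≤ (N + j) !
  factorial zero    = ≤-reflexive (+-identityʳ (j !))
  factorial (suc N) = begin
    j * j ^ N * j !          ≡⟨ *-assoc j (j ^ N) (j !) ⟩
    j * (j ^ N * j !)        ≤⟨ *-mono-≤ (≤-trans (m≤n+m j N) (n≤1+n _)) (factorial N) ⟩
    suc (N + j) * (N + j) !  ∎

-- The previous bound applies to `j = n ∸ N`, which is at least half of `n`; this costs the factor
-- `2 ^ N`.
n^N≤binomial : ∀ n N → 2 * N ≤ n → n ^ N ≤ 2 ^ N * N ! * (n C N)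
n^N≤binomial n N 2N≤n = begin
  n ^ N                            ≤⟨ ^-monoˡ-≤ N n≤2j ⟩
  (2 * j) ^ N                      ≡⟨ ^-distribʳ-* N 2 j ⟩
  2 ^ N * j ^ N                    ≤⟨ *-monoʳ-≤ (2 ^ N) (^-lower-binomial N j) ⟩
  2 ^ N * (N ! * ((N + j) C N))    ≡⟨ cong (λ i → 2 ^ N * (N ! * (i C N))) (m+[n∸m]≡n N≤n) ⟩
  2 ^ N * (N ! * (n C N))          ≡⟨ *-assoc (2 ^ N) (N !) (n C N) ⟨
  2 ^ N * N ! * (n C N)            ∎
  where
  open ≤-Reasoning
  j = n ∸ N
  N≤n : N ≤ n
  N≤n = ≤-trans (m≤m+n N _) 2N≤n
  N≤j : N ≤ j
  N≤j = ≤-trans (≤-reflexive (sym (trans (cong (λ z → N + z ∸ N) (+-identityʳ N)) (m+n∸m≡n N N)))) (∸-monoˡ-≤ N 2N≤n)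
  n≤2j : n ≤ 2 * j
  n≤2j = begin
    n          ≡⟨ m+[n∸m]≡n N≤n ⟨
    N + j      ≤⟨ +-monoˡ-≤ j N≤j ⟩
    j + j      ≡⟨ cong (j +_) (+-identityʳ j) ⟨
    2 * j      ∎

-- `E ^ 4` stands for the `m`-th root of `n`: taking `m`-th roots in the hypothesis on `a` and `b`
-- leaves `suc E ^ 4`, at most `16 * E ^ 4`. With the factor 8 from comparing `n * n` to `n C 2`
-- this gives `128 = 16 * 8`. Base 2 passes to base `k` because `2 ≤ k`.
logBound : ∀ {k L Q E C′ n m} → 2 ≤ k → 0 < m → 1 ≤ E → n < suc E ^ (4 * m) → n * n ≤ 8 * (n C 2) →
           L ≤ 2 ^ Q → Q * E ^ 4 ≤ C′ * (n * n) → LogBound k L (C′ * 128) n m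
logBound {k} {L} {Q} {E} {C′} {n} {m} 2≤k 0<m 1≤E n< n²≤ L≤ Q≤ a b hyp = begin
  L ^ suc b            ≤⟨ ^-monoˡ-≤ (suc b) L≤ ⟩
  (2 ^ Q) ^ suc b      ≡⟨ ^-*-assoc 2 Q (suc b) ⟩
  2 ^ (Q * suc b)      ≤⟨ ^-monoʳ-≤ 2 QB≤a ⟩
  2 ^ a                ≤⟨ ^-monoˡ-≤ a 2≤k ⟩
  k ^ a                ∎
  where
  open ≤-Reasoning
  E⁴ = E ^ 4
  scaled : C′ * 128 * (n C 2) * suc b ≤ a * suc E ^ 4
  scaled = ^-cancelˡ-≤ m 0<m (begin
    (C′ * 128 * (n C 2) * suc b) ^ m    ≤⟨ hyp ⟩
    a ^ m * n                           ≤⟨ *-monoʳ-≤ (a ^ m) (<⇒≤ n<) ⟩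
    a ^ m * suc E ^ (4 * m)             ≡⟨ cong (a ^ m *_) (^-*-assoc (suc E) 4 m) ⟨
    a ^ m * (suc E ^ 4) ^ m             ≡⟨ ^-distribʳ-* m a (suc E ^ 4) ⟨
    (a * suc E ^ 4) ^ m                 ∎)
  [1+E]⁴≤ : suc E ^ 4 ≤ 16 * E⁴
  [1+E]⁴≤ = ≤-trans (^-monoˡ-≤ 4 (+-monoˡ-≤ E 1≤E)) (≤-reflexive (quartic E))
    where
    quartic : ∀ e → (e + e) * ((e + e) * ((e + e) * ((e + e) * 1))) ≡ 16 * (e * (e * (e * (e * 1))))
    quartic = solve-∀
  QB≤a : Q * suc b ≤ a
  QB≤a = *-cancelʳ-≤ (Q * suc b) a (16 * E⁴) ⦃ >-nonZero (*-mono-< {0} {16} {0} (s≤s z≤n) (m^n>0 E ⦃ >-nonZero 1≤E ⦄ 4)) ⦄ (begin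
    Q * suc b * (16 * E⁴)              ≡⟨ shuffle Q (suc b) E⁴ ⟩
    16 * (Q * E⁴) * suc b              ≤⟨ *-monoˡ-≤ (suc b) (*-monoʳ-≤ 16 (≤-trans Q≤ (*-monoʳ-≤ C′ n²≤))) ⟩
    16 * (C′ * (8 * (n C 2))) * suc b  ≡⟨ cong (_* suc b) (shuffle′ C′ (n C 2)) ⟩
    C′ * 128 * (n C 2) * suc b         ≤⟨ scaled ⟩
    a * suc E ^ 4                      ≤⟨ *-monoʳ-≤ a [1+E]⁴≤ ⟩
    a * (16 * E⁴)                      ∎)
    where
    shuffle : ∀ q b e → q * b * (16 * e) ≡ 16 * (q * e) * b
    shuffle = solve-∀
    shuffle′ : ∀ c x → 16 * (c * (8 * x)) ≡ c * 128 * x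
    shuffle′ = solve-∀

-- Equality holds at `r = 3`, while `r = 1` violates the inequality; hence the separate treatment of
-- `N = 2`.
5r+5≤4[2r-1] : ∀ r → 3 ≤ r → r * 5 + 1 + 4 ≤ 4 * (2 * r ∸ 1)
5r+5≤4[2r-1] (suc (suc (suc s))) (s≤s (s≤s (s≤s z≤n))) = begin
  (3 + s) * 5 + 1 + 4          ≡⟨ lhs s ⟩
  20 + 5 * s                   ≤⟨ +-monoʳ-≤ 20 (*-monoˡ-≤ s {5} {8} (s≤s (s≤s (s≤s (s≤s (s≤s z≤n)))))) ⟩
  20 + 8 * s                   ≡⟨ rhs s ⟩
  4 * (5 + 2 * s)              ≡⟨ cong (λ z → 4 * (z ∸ 1)) (dbl s) ⟨
  4 * (2 * (3 + s) ∸ 1)        ∎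
  where
  open ≤-Reasoning
  lhs : ∀ s → (3 + s) * 5 + 1 + 4 ≡ 20 + 5 * s
  lhs = solve-∀
  rhs : ∀ s → 20 + 8 * s ≡ 4 * (5 + 2 * s)
  rhs = solve-∀
  dbl : ∀ s → 2 * (3 + s) ≡ 6 + 2 * s
  dbl = solve-∀

-- `Q` counts the bits of `r` fingerprints. A letter takes order `n` bits, and there are at most
-- `n / E ^ 4` of them; an exception takes order `E` bits, and there are of order `n * n / E ^ 5`.
-- Both parts are of order `n * n / E ^ 4`.
fingerprint-count : ∀ k N r c̄ {n E maxLetters maxExceptions} → 1 ≤ E → 3 ≤ r → let m = 2 * r ∸ 1 in
  E ^ (4 * m) ≤ n → n < suc E ^ (4 * m) →
  maxLetters ≡ E ^ (r * 5 + 1) → maxExceptions * E ^ 5 ≤ c̄ * (n * (n * k)) →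
  ∃ λ Q → (suc ((k ^ N) ^ N * n ^ N * (2 ^ n * 2 ^ n)) ^ maxLetters * suc (n * (n * k)) ^ maxExceptions) ^ r ≤ 2 ^ Q
        × Q * E ^ 4 ≤ r * ((3 + k * N * N + N) + (1 + 8 * m + k) * c̄ * k) * (n * n)
fingerprint-count k N r c̄ {n} {E} {ml} {me} 1≤E 3≤r E^≤n n< refl me≤ = Q , size , small
  where
  open ≤-Reasoning
  m  = 2 * r ∸ 1
  -- `C₁ * n` bits specify a letter or a blank, `C₂ * E` bits a point or a blank.
  C₁ = 3 + k * N * N + N
  C₂ = 1 + 8 * m + k
  Q  = (C₁ * n * ml + C₂ * E * me) * r
  1≤n : 1 ≤ n
  1≤n = ≤-trans (m^n>0 E ⦃ >-nonZero 1≤E ⦄ (4 * m)) E^≤n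
  1+letters≤ : suc ((k ^ N) ^ N * n ^ N * (2 ^ n * 2 ^ n)) ≤ 2 ^ (C₁ * n)
  1+letters≤ = ≤-trans (1+n≤2^1+m e₁ (begin
      (k ^ N) ^ N * n ^ N * (2 ^ n * 2 ^ n)
        ≤⟨ *-monoˡ-≤ _ (*-mono-≤ (^-monoˡ-≤ N (^-monoˡ-≤ N (<⇒≤ (n<2^n k)))) (^-monoˡ-≤ N (<⇒≤ (n<2^n n)))) ⟩
      ((2 ^ k) ^ N) ^ N * (2 ^ n) ^ N * (2 ^ n * 2 ^ n)
        ≡⟨ cong₂ _*_ (cong₂ _*_ (trans (cong (_^ N) (^-*-assoc 2 k N)) (^-*-assoc 2 (k * N) N)) (^-*-assoc 2 n N))
                     (sym (^-distribˡ-+-* 2 n n)) ⟩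
      2 ^ (k * N * N) * 2 ^ (n * N) * 2 ^ (n + n)
        ≡⟨ trans (cong (_* 2 ^ (n + n)) (sym (^-distribˡ-+-* 2 (k * N * N) (n * N)))) (sym (^-distribˡ-+-* 2 (k * N * N + n * N) (n + n))) ⟩
      2 ^ e₁ ∎))
    (^-monoʳ-≤ 2 (begin
      suc e₁                                ≤⟨ +-mono-≤ 1≤n (+-monoˡ-≤ (n + n) (+-monoˡ-≤ (n * N) (≤-trans (≤-reflexive (sym (*-identityʳ (k * N * N)))) (*-monoʳ-≤ (k * N * N) 1≤n)))) ⟩
      n + (k * N * N * n + n * N + (n + n)) ≡⟨ collect n (k * N * N) N ⟩
      C₁ * n                                ∎))
    where
    e₁ = k * N * N + n * N + (n + n)
    collect : ∀ n x N → n + (x * n + n * N + (n + n)) ≡ (3 + x + N) * n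
    collect = solve-∀
  -- The logarithm of `n` is bounded crudely by a multiple of `E`. This spends one of the five
  -- powers of `E` saved on exceptions.
  n≤ : n ≤ 2 ^ (E * (4 * m))
  n≤ = begin
    n                     ≤⟨ <⇒≤ n< ⟩
    suc E ^ (4 * m)       ≤⟨ ^-monoˡ-≤ (4 * m) (n<2^n E) ⟩
    (2 ^ E) ^ (4 * m)     ≡⟨ ^-*-assoc 2 E (4 * m) ⟩
    2 ^ (E * (4 * m))     ∎
  1+points≤ : suc (n * (n * k)) ≤ 2 ^ (C₂ * E)
  1+points≤ = ≤-trans (1+n≤2^1+m e₂ (begin
      n * (n * k)                                        ≤⟨ *-mono-≤ n≤ (*-mono-≤ n≤ (<⇒≤ (n<2^n k))) ⟩
      2 ^ (E * (4 * m)) * (2 ^ (E * (4 * m)) * 2 ^ k)    ≡⟨ cong (2 ^ (E * (4 * m)) *_) (^-distribˡ-+-* 2 (E * (4 * m)) k) ⟨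
      2 ^ (E * (4 * m)) * 2 ^ (E * (4 * m) + k)          ≡⟨ ^-distribˡ-+-* 2 (E * (4 * m)) _ ⟨
      2 ^ e₂                                             ∎))
    (^-monoʳ-≤ 2 (begin
      suc e₂                                        ≤⟨ +-mono-≤ 1≤E (+-monoʳ-≤ (E * (4 * m)) (+-monoʳ-≤ (E * (4 * m)) (≤-trans (≤-reflexive (sym (*-identityʳ k))) (*-monoʳ-≤ k 1≤E)))) ⟩
      E + (E * (4 * m) + (E * (4 * m) + k * E))     ≡⟨ collect E m k ⟩
      C₂ * E                                        ∎))
    where
    e₂ = E * (4 * m) + (E * (4 * m) + k)
    collect : ∀ e m k → e + (e * (4 * m) + (e * (4 * m) + k * e)) ≡ (1 + 8 * m + k) * e
    collect = solve-∀
  size : (suc ((k ^ N) ^ N * n ^ N * (2 ^ n * 2 ^ n)) ^ ml * suc (n * (n * k)) ^ me) ^ r ≤ 2 ^ Q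
  size = begin
    _                                              ≤⟨ ^-monoˡ-≤ r (*-mono-≤ (^-monoˡ-≤ ml 1+letters≤) (^-monoˡ-≤ me 1+points≤)) ⟩
    ((2 ^ (C₁ * n)) ^ ml * (2 ^ (C₂ * E)) ^ me) ^ r
      ≡⟨ cong (_^ r) (cong₂ _*_ (^-*-assoc 2 (C₁ * n) ml) (^-*-assoc 2 (C₂ * E) me)) ⟩
    (2 ^ (C₁ * n * ml) * 2 ^ (C₂ * E * me)) ^ r    ≡⟨ cong (_^ r) (^-distribˡ-+-* 2 (C₁ * n * ml) _) ⟨
    (2 ^ (C₁ * n * ml + C₂ * E * me)) ^ r          ≡⟨ ^-*-assoc 2 (C₁ * n * ml + C₂ * E * me) r ⟩
    2 ^ Q                                          ∎
  mlE⁴≤n : ml * E ^ 4 ≤ n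
  mlE⁴≤n = begin
    E ^ (r * 5 + 1) * E ^ 4    ≡⟨ ^-distribˡ-+-* E (r * 5 + 1) 4 ⟨
    E ^ (r * 5 + 1 + 4)        ≤⟨ ^-monoʳ-≤ E ⦃ >-nonZero 1≤E ⦄ (5r+5≤4[2r-1] r 3≤r) ⟩
    E ^ (4 * m)                ≤⟨ E^≤n ⟩
    n                          ∎
  small : Q * E ^ 4 ≤ r * (C₁ + C₂ * c̄ * k) * (n * n)
  small = begin
    (C₁ * n * ml + C₂ * E * me) * r * E ^ 4                ≡⟨ expand C₁ n ml C₂ E me r ⟩
    r * (C₁ * n * (ml * E ^ 4) + C₂ * (me * E ^ 5))        ≤⟨ *-monoʳ-≤ r (+-mono-≤ (*-monoʳ-≤ (C₁ * n) mlE⁴≤n) (*-monoʳ-≤ C₂ me≤)) ⟩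
    r * (C₁ * n * n + C₂ * (c̄ * (n * (n * k))))            ≡⟨ collect r C₁ n C₂ c̄ k ⟩
    r * (C₁ + C₂ * c̄ * k) * (n * n)                        ∎
    where
    expand : ∀ c n l d e x r → (c * n * l + d * e * x) * r * (e * (e * (e * (e * 1))))
             ≡ r * (c * n * (l * (e * (e * (e * (e * 1))))) + d * (x * (e * (e * (e * (e * (e * 1)))))))
    expand = solve-∀
    collect : ∀ r c n d b k → r * (c * n * n + d * (b * (n * (n * k)))) ≡ r * (c + d * b * k) * (n * n)
    collect = solve-∀

-- Templates as sets of points

module _ {A : Set} {p : A → Bool} where

  all-true⁺ : ∀ {xs} → All (λ x → p x ≡ true) xs → all p xs ≡ true
  all-true⁺ []         = refl
  all-true⁺ (px ∷ pxs) = ∧-true⁺ px (all-true⁺ pxs)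

  all-true⁻ : ∀ {x xs} → all p xs ≡ true → x ∈ xs → p x ≡ true
  all-true⁻ pxs (here refl)  = proj₁ (∧-true⁻ pxs)
  all-true⁻ pxs (there x∈xs) = all-true⁻ (proj₂ (∧-true⁻ pxs)) x∈xs

does⇒ : ∀ {P : Set} (P? : Dec P) → does P? ≡ true → P
does⇒ (yes p) _ = p

All-ʳ++⁺ : ∀ {A : Set} {P : A → Set} {xs ys} → All P xs → All P ys → All P (xs ʳ++ ys)
All-ʳ++⁺ []         pys = pys
All-ʳ++⁺ (px ∷ pxs) pys = All-ʳ++⁺ pxs (px ∷ pys)

∈-tabulate⁺ : ∀ {k} (b : Fin k → Bool) {c} → b c ≡ true → c ∈ˢ Vec.tabulate b
∈-tabulate⁺ b {c} bc = lookup⇒[]= c _ (trans (lookup∘tabulate b c) bc)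

∈-tabulate⁻ : ∀ {k} (b : Fin k → Bool) {c} → c ∈ˢ Vec.tabulate b → b c ≡ true
∈-tabulate⁻ b {c} c∈ = trans (sym (lookup∘tabulate b c)) ([]=⇒lookup c∈)

embedding-injective : ∀ {m n} {φ : Fin m → Fin n} → IsEmbedding φ → ∀ {i j} → φ i ≡ φ j → i ≡ j
embedding-injective {φ = φ} emb {i} {j} eq with Finₚ.<-cmp i j
... | tri< i<j _ _ = ⊥-elim (Finₚ.<-irrefl eq (emb i j i<j))
... | tri≈ _ i≡j _ = i≡j
... | tri> _ _ j<i = ⊥-elim (Finₚ.<-irrefl (sym eq) (emb j i j<i))

-- Any choice of colours on a single copy extends to a colouring of K_n that follows t.
no-copy-in-forb : ∀ {N n k} {F : List (Colouring N k)} (t : Template n k) → ⟨ t ⟩⊆Forb F → Fin k →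
                  {φ : Fin N → Fin n} → IsEmbedding φ → {f : Colouring N k} → f ∈𝓕 F →
                  ¬ f ∈⟨ (λ i j → proj₁ t (φ i) (φ j)) ⟩
no-copy-in-forb {N} {n} {k} (t , nonempty) forb default {φ} emb {f} f∈F f∈t =
  forb c (λ u v u<v → pick∈t u v u<v (onCopy? u v)) φ emb
    (Any.map (λ f≈g i j i<j → trans (pick≡f i j (onCopy? (φ i) (φ j)) i<j) (f≈g i j i<j)) f∈F)
  where
  OnCopy : Fin n → Fin n → Set
  OnCopy u v = ∃ λ i → ∃ λ j → i Fin.< j × φ i ≡ u × φ j ≡ v
  onCopy? : ∀ u v → Dec (OnCopy u v)
  onCopy? u v = Finₚ.any? λ i → Finₚ.any? λ j → (i Finₚ.<? j) ×-dec ((φ i Finₚ.≟ u) ×-dec (φ j Finₚ.≟ v))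
  -- Pairs with `u ≥ v` are junk for a colouring but still need a value, which `default` supplies.
  elsewhere : ∀ u v → Dec (u Fin.< v) → Fin k
  elsewhere u v (yes u<v) = proj₁ (nonempty u v u<v)
  elsewhere u v (no  _)   = default
  pick : ∀ u v → Dec (OnCopy u v) → Fin k
  pick u v (yes (i , j , _)) = f i j
  pick u v (no _)            = elsewhere u v (u Finₚ.<? v)
  c : Colouring n k
  c u v = pick u v (onCopy? u v)
  pick∈t : ∀ u v → u Fin.< v → (d : Dec (OnCopy u v)) → pick u v d ∈ˢ t u v
  pick∈t u v u<v (yes (i , j , i<j , refl , refl)) = f∈t i j i<j
  pick∈t u v u<v (no _) with u Finₚ.<? v
  ... | yes u<v′ = proj₂ (nonempty u v u<v′)
  ... | no  u≮v  = ⊥-elim (u≮v u<v)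
  pick≡f : ∀ i j (d : Dec (OnCopy (φ i) (φ j))) → i Fin.< j → pick (φ i) (φ j) d ≡ f i j
  pick≡f i j (yes (i′ , j′ , _ , eqᵢ , eqⱼ)) i<j = cong₂ f (embedding-injective emb eqᵢ) (embedding-injective emb eqⱼ)
  pick≡f i j (no ¬onCopy) i<j = ⊥-elim (¬onCopy (i , j , i<j , refl , refl))

module Family {N k : ℕ} (n : ℕ) (F : List (Colouring N k)) where

  colouring : Vec (Vec (Fin k) N) N → Colouring N k
  colouring f i j = lookup (lookup f i) j

  embedding? : (φ : Vec (Fin n) N) → Dec (IsEmbedding (lookup φ))
  embedding? φ = Finₚ.all? λ i → Finₚ.all? λ j → (i Finₚ.<? j) →-dec (lookup φ i Finₚ.<? lookup φ j)

  forbidden? : ∀ f → Dec (colouring f ∈𝓕 F)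
  forbidden? f = Any.any? (λ g → Finₚ.all? λ i → Finₚ.all? λ j → (i Finₚ.<? j) →-dec (colouring f i j Finₚ.≟ g i j)) F

  valid : Placement n k N → Bool
  valid (f , φ) = does (embedding? φ) ∧ does (forbidden? f)

  open Copies valid public

  fromTemplate : Template n k → X → Bool
  fromTemplate t (u , v , c) = lookup (proj₁ t u v) c

  toSubsets : (X → Bool) → Fin n → Fin n → Subset k
  toSubsets T u v = Vec.tabulate λ c → T (u , v , c)

  -- Starts the iteration: before any edge is processed, a copy would lie entirely in `t`, against
  -- `no-copy-in-forb`.
  #copies-forb : ∀ t → ⟨ t ⟩⊆Forb F → Fin k → ∀ T → #copies T (fromTemplate t) [] (edges N) ≡ 0
  #copies-forb t forb default T = trans (∑-cong placements (λ w → none w _ refl)) (∑-zero placements)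
    where
    none : ∀ w b → copy T (fromTemplate t) [] (edges N) w ≡ b → 𝟙 b ≡ 0
    none w       false _      = refl
    none (f , φ) true  isCopy with ∧-true⁻ {valid (f , φ)} isCopy
    ... | v , inside with ∧-true⁻ {does (embedding? φ)} v
    ...   | emb , forbidden = ⊥-elim (no-copy-in-forb t forb default (does⇒ (embedding? φ) emb) (does⇒ (forbidden? f) forbidden)
            λ i j i<j → lookup⇒[]= _ _ (all-true⁻ inside (edges-complete i j i<j)))

  -- Junk entries of the colouring are kept, so pairs that agree up to `≈E` may have several codes.
  -- Pairs that are `DistinctPairs` never share one, and the count rests on that.
  encode : Pair N n k → W
  encode (φ , c) = Vec.tabulate (λ i → Vec.tabulate (c i)) , Vec.tabulate φ

  colouring-encode : ∀ (c : Colouring N k) i j → colouring (Vec.tabulate (λ i → Vec.tabulate (c i))) i j ≡ c i j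
  colouring-encode c i j = trans (cong (λ v → lookup v j) (lookup∘tabulate _ i)) (lookup∘tabulate (c i) j)

  encode-injective : ∀ p q → encode p ≡ encode q → ¬ DistinctPairs p q
  encode-injective (φ , c) (ψ , d) eq distinct = distinct
    ( (λ i → trans (sym (lookup∘tabulate φ i)) (trans (cong (λ w → lookup (proj₂ w) i) eq) (lookup∘tabulate ψ i)))
    , (λ i j _ → trans (sym (colouring-encode c i j)) (trans (cong (λ w → colouring (proj₁ w) i j) eq) (colouring-encode d i j))))

  copy-encode : ∀ T nonempty p → GoodPair F (toSubsets T , nonempty) p → ∀ {es} → All Increasing es →
                copy T T es [] (encode p) ≡ true
  copy-encode T _ (φ , c) (emb , c∈F , c∈T) incr = ∧-true⁺
    (∧-true⁺ (dec-true (embedding? (Vec.tabulate φ)) λ i j i<j → subst₂ Fin._<_ (sym (lookup∘tabulate φ i)) (sym (lookup∘tabulate φ j)) (emb i j i<j))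
             (dec-true (forbidden? (Vec.tabulate λ i → Vec.tabulate (c i))) (Any.map (λ c≈g i j i<j → trans (colouring-encode c i j) (c≈g i j i<j)) c∈F)))
    (∧-true⁺ (all-true⁺ (All.map (λ {e} → inside e) incr)) refl)
    where
    inside : ∀ e → Increasing e → T (pointAt e (encode (φ , c))) ≡ true
    inside (i , j) i<j = trans
      (cong T (cong₂ _,_ (lookup∘tabulate φ i) (cong₂ _,_ (lookup∘tabulate φ j) (colouring-encode c i j))))
      (∈-tabulate⁻ (λ c → T (φ i , φ j , c)) (c∈T i j i<j))

  length-pairs-≤ : ∀ T nonempty es → All Increasing es → ∀ ps → AllPairs DistinctPairs ps →
                   All (GoodPair F (toSubsets T , nonempty)) ps → length ps ≤ #copies T T es []
  length-pairs-≤ T nonempty es incr ps distinct good = ≤-trans (≤-reflexive (sym (length-map encode ps)))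
    (unique-length-≤ (copy T T es []) placements
      (AllPairsₚ.map⁺ (AllPairs.map (λ {p} {q} d eq → encode-injective p q eq d) distinct))
      (Allₚ.map⁺ (All.map (λ {p} g → ∈-placements (encode p) , copy-encode T nonempty p g incr) good)))

  AllNonempty : (X → Bool) → Set
  AllNonempty T = ∀ i j → i Fin.< j → Nonempty (toSubsets T i j)

  nonempty-template? : ∀ T → Dec (AllNonempty T)
  nonempty-template? T = Finₚ.all? λ i → Finₚ.all? λ j → (i Finₚ.<? j) →-dec nonempty? (toSubsets T i j)

  -- Drops the leaves with too many copies or with an edge lacking colours. A good leaf above a
  -- template survives, since it inherits nonemptiness from the template.
  module Selection (Good : (X → Bool) → Set) (good? : ∀ T → Dec (Good T)) where

    keep : ∀ T → Dec (Good T) → Dec (AllNonempty T) → List (Template n k)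
    keep T (yes _) (yes nonempty) = (toSubsets T , nonempty) ∷ []
    keep T _       _              = []

    select : List (X → Bool) → List (Template n k)
    select = concatMap λ T → keep T (good? T) (nonempty-template? T)

    length-select-≤ : ∀ Ts → length (select Ts) ≤ length Ts
    length-select-≤ Ts = ≤-trans (length-concatMap-≤ _ (λ T → short T (good? T) (nonempty-template? T)) Ts) (≤-reflexive (*-identityʳ _))
      where
      short : ∀ T g ne → length (keep T g ne) ≤ 1
      short T (yes _) (yes _) = ≤-refl
      short T (yes _) (no _)  = z≤n
      short T (no _)  _       = z≤n

    ∈-select⁺ : ∀ {T Ts} → T ∈ Ts → Good T → AllNonempty T →
                ∃ λ nonempty → (toSubsets T , nonempty) ∈ select Ts
    ∈-select⁺ {T} {Ts} T∈Ts good nonempty = Product.map id (λ t∈ → ∈-concatMap⁺ (λ T → keep T (good? T) (nonempty-template? T)) (lose T∈Ts t∈))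
      (kept (good? T) (nonempty-template? T))
      where
      kept : ∀ g ne → ∃ λ nonempty → (toSubsets T , nonempty) ∈ keep T g ne
      kept (yes _) (yes ne) = ne , here refl
      kept (yes _) (no ¬ne) = ⊥-elim (¬ne nonempty)
      kept (no ¬g) _        = ⊥-elim (¬g good)

    ∈-select⁻ : ∀ {t} Ts → t ∈ select Ts → ∃ λ T → Good T × ∃ λ nonempty → t ≡ (toSubsets T , nonempty)
    ∈-select⁻ Ts t∈ with Any.satisfied (∈-concatMap⁻ (λ T → keep T (good? T) (nonempty-template? T)) {xs = Ts} t∈)
    ... | T , t∈keep = T , kept (good? T) (nonempty-template? T) t∈keep
      where
      kept : ∀ g ne {t} → t ∈ keep T g ne → Good T × ∃ λ nonempty → t ≡ (toSubsets T , nonempty)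
      kept (yes g) (yes ne) (here refl) = g , ne , refl

-- The cases `N = 2` and `N ≥ 3`

3≤NC2 : ∀ {N} → 3 ≤ N → 3 ≤ N C 2
3≤NC2 {suc N} 3≤1+N with m≤n⇒m<n∨m≡n 3≤1+N
... | inj₂ refl = ≤-refl
... | inj₁ (s≤s 3≤N) = ≤-trans (3≤NC2 3≤N) (≤-trans (m≤n+m _ (N C 1)) (≤-reflexive (nCk+nC[k+1]≡[n+1]C[k+1] N 1)))

ContainerTheorem : ℕ → ℕ → Set
ContainerTheorem k N = ∀ (p q : ℕ)
    → Σ ℕ λ C₀ → Σ ℕ λ n₀
    → ∀ (𝓕 : List (Colouring N k)) → 𝓕 ≢ []
    → ∀ (n : ℕ) → n₀ ≤ n
    → Σ (List (Template n k)) λ 𝓣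
    → IsContainerFamily 𝓕 𝓣
    × (∀ (t : Template n k) → t ∈ 𝓣 → FewPairs 𝓕 t p q)
    × LogBound k (length 𝓣) C₀ n (2 * (N C 2) ∸ 1)

-- A copy is now one edge with a colour occurring in the family, so the template allowing exactly
-- the other colours contains every template inside Forb and has no bad pairs. At most one container
-- is used, so `C₀` can be 0.
single-edge : ∀ k → 2 ≤ k → ContainerTheorem k 2
single-edge k 2≤k p q = 0 , 2 , λ 𝓕 _ → family 𝓕
  where
  module _ (𝓕 : List (Colouring 2 k)) where

    used? : ∀ c → Dec (Any (λ g → c ≡ g zero (suc zero)) 𝓕)
    used? c = Any.any? (λ g → c Finₚ.≟ g zero (suc zero)) 𝓕

    allowed : Subset k
    allowed = Vec.tabulate λ c → not (does (used? c))

    t⊆allowed : ∀ {n} (t : Template n k) → ⟨ t ⟩⊆Forb 𝓕 → ∀ i j → i Fin.< j → ∀ {c} → c ∈ˢ proj₁ t i j → c ∈ˢ allowed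
    t⊆allowed t forb i j i<j {c} c∈t = ∈-tabulate⁺ (λ c → not (does (used? c))) (cong not (dec-false (used? c) λ used →
      no-copy-in-forb t forb c {φ} (λ { zero (suc zero) _ → i<j ; (suc zero) (suc zero) (s≤s ()) })
        {λ _ _ → c} (Any.map (λ { c≡g zero (suc zero) _ → c≡g ; _ (suc zero) (suc zero) (s≤s ()) }) used)
        (λ { zero (suc zero) _ → c∈t ; (suc zero) (suc zero) (s≤s ()) })))
      where
      φ : Fin 2 → Fin _
      φ zero    = i
      φ (suc _) = j

    few : ∀ {n} nonempty → FewPairs {n = n} 𝓕 ((λ _ _ → allowed) , nonempty) p q
    few nonempty []             _ _ = z≤n
    few nonempty ((φ , c) ∷ _)  _ ((_ , c∈F , c∈t) ∷ _)
      with used? (c zero (suc zero)) | ∈-tabulate⁻ (λ c → not (does (used? c))) (c∈t zero (suc zero) (s≤s z≤n))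
    ... | no ¬used | _ = ⊥-elim (¬used (Any.map (λ c≈g → c≈g zero (suc zero) (s≤s z≤n)) c∈F))

    power : ∀ a b {x} → x ≤ 1 → x ^ suc b ≤ k ^ a
    power a b x≤1 = ≤-trans (^-monoˡ-≤ (suc b) x≤1) (≤-trans (≤-reflexive (^-zeroˡ (suc b))) (m^n>0 k ⦃ >-nonZero (≤-trans (s≤s z≤n) 2≤k) ⦄ a))

    family : ∀ n → 2 ≤ n → Σ (List (Template n k)) λ 𝓣 → IsContainerFamily 𝓕 𝓣
           × (∀ (t : Template n k) → t ∈ 𝓣 → FewPairs 𝓕 t p q) × LogBound k (length 𝓣) 0 n 1
    family (suc zero) (s≤s ())
    family (suc (suc n)) _ with nonempty? allowed
    ... | yes nonempty = (container ∷ []) , (λ t forb → container , here refl , t⊆allowed t forb)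
                       , (λ { _ (here refl) → few (λ _ _ _ → nonempty) }) , (λ a b _ → power a b ≤-refl)
      where
      container : Template (suc (suc n)) k
      container = (λ _ _ → allowed) , (λ _ _ _ → nonempty)
    -- With no colour left, a template inside Forb would have none on the edge from `zero` to
    -- `suc zero`, which exists because `2 ≤ n`; the empty family suffices.
    ... | no empty = [] , (λ t forb → ⊥-elim (empty (Product.map id (t⊆allowed t forb zero (suc zero) (s≤s z≤n))
                                                      (proj₂ t zero (suc zero) (s≤s z≤n)))))
                   , (λ _ ()) , (λ a b _ → power a b z≤n)

several-edges : ∀ k N → 2 ≤ k → 3 ≤ N → ContainerTheorem k N
several-edges k N 2≤k 3≤N p q = C′ * 128 , E₀ ^ (4 * m) , λ 𝓕 _ n n₀≤n → proof 𝓕 n n₀≤n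
  where
  open ≤-Reasoning
  r  = N C 2
  m  = 2 * r ∸ 1
  -- The initial `c = 1` plus 2 for each of the `r` edges.
  c̄  = 1 + 2 * r
  κ  = (k ^ N) ^ N
  C′ = r * ((3 + k * N * N + N) + (1 + 8 * m + k) * c̄ * k)
  -- `κ` and `k` count colour matrices and colours; `2 ^ N * N !` is the loss in passing from
  -- `n ^ N` to `n C N`.
  D  = c̄ * κ * k * (2 ^ N * N !)
  -- `4 + 2 * N` makes `n` large enough for the binomial bound at exponents 2 and `N`; `suc q * D`
  -- lets the saved factor `E` beat the required density.
  E₀ = 4 + 2 * N + suc q * D
  3≤r : 3 ≤ r
  3≤r = 3≤NC2 3≤N
  0<k : 0 < k
  0<k = ≤-trans (s≤s z≤n) 2≤k
  0<m : 0 < m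
  0<m = ≤-trans (s≤s z≤n) (∸-monoˡ-≤ 1 (*-monoʳ-≤ 2 3≤r))

  module _ (𝓕 : List (Colouring N k)) (n : ℕ) (n₀≤n : E₀ ^ (4 * m) ≤ n)
           (E : ℕ) (E^≤n : E ^ (4 * m) ≤ n) (n< : n < suc E ^ (4 * m)) where

    E₀≤E : E₀ ≤ E
    E₀≤E with E₀ ≤? E
    ... | yes E₀≤E = E₀≤E
    ... | no  E₀≰E = ⊥-elim (<⇒≱ n< (≤-trans (^-monoˡ-≤ (4 * m) (≰⇒> E₀≰E)) n₀≤n))
    1≤E : 1 ≤ E
    1≤E = ≤-trans (s≤s z≤n) E₀≤E
    instance
      E≢0 : NonZero E
      E≢0 = >-nonZero 1≤E
      E⁵≢0 : NonZero (E ^ 5)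
      E⁵≢0 = m^n≢0 E 5
    E≤n : E ≤ n
    E≤n = begin
      E             ≡⟨ ^-identityʳ E ⟨
      E ^ 1         ≤⟨ ^-monoʳ-≤ E (*-mono-≤ {1} {4} (s≤s z≤n) 0<m) ⟩
      E ^ (4 * m)   ≤⟨ E^≤n ⟩
      n             ∎
    1≤n : 1 ≤ n
    1≤n = ≤-trans 1≤E E≤n
    2N≤n : 2 * N ≤ n
    2N≤n = ≤-trans (m≤n+m (2 * N) 4) (≤-trans (m≤m+n (4 + 2 * N) (suc q * D)) (≤-trans E₀≤E E≤n))
    n²≤ : n * n ≤ 8 * (n C 2)
    n²≤ = ≤-trans (≤-reflexive (cong (n *_) (sym (*-identityʳ n))))
            (n^N≤binomial n 2 (≤-trans (m≤m+n 4 (2 * N + suc q * D)) (≤-trans E₀≤E E≤n)))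

    open Family n 𝓕

    maxLetters    = E ^ (r * 5 + 1)
    maxExceptions = c̄ * (n * (n * k)) / E ^ 5

    open Containers valid maxLetters maxExceptions

    ∣W∣∣X∣ = length placements * length points

    n≤∣X∣ : n ≤ length points
    n≤∣X∣ = begin
      n              ≡⟨ *-identityʳ n ⟨
      n * 1          ≤⟨ *-monoʳ-≤ n (*-mono-≤ 1≤n 0<k) ⟩
      n * (n * k)    ≡⟨ length-points ⟨
      length points  ∎
    0<∣W∣ : 0 < length placements
    0<∣W∣ = ≤-trans (*-mono-≤ (m^n>0 (k ^ N) ⦃ m^n≢0 k N ⦃ >-nonZero 0<k ⦄ ⦄ N) (m^n>0 n ⦃ >-nonZero 1≤n ⦄ N))
                    (≤-reflexive (sym length-placements))

    processed = edges N ʳ++ []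

    Good : (X → Bool) → Set
    -- Once every edge is processed, the unprocessed part of a copy is empty, so `T` can stand in
    -- place of `t` and the condition depends on the leaf alone.
    Good T = E * (n * (n * #copies T T processed [])) ≤ c̄ * ∣W∣∣X∣

    open Selection Good (λ T → _ ≤? _)

    𝓣 : List (Template n k)
    𝓣 = select (containers [] (edges N) (λ _ → true))

    container-family : IsContainerFamily 𝓕 𝓣
    container-family t forb = (toSubsets T , nonempty) , T∈𝓣 , λ i j i<j → t⊆T′ i j
      where
      M≤n : E ^ (length (edges N) * 5 + 1) ≤ n
      M≤n = begin
        E ^ (length (edges N) * 5 + 1)   ≡⟨ cong (λ l → E ^ (l * 5 + 1)) (length-edges N) ⟩
        E ^ (r * 5 + 1)                  ≤⟨ ^-monoʳ-≤ E (≤-trans (m≤m+n _ 4) (5r+5≤4[2r-1] r 3≤r)) ⟩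
        E ^ (4 * m)                      ≤⟨ E^≤n ⟩
        n                                ∎
      result = container-exists E c̄ 1≤E (≤-trans 1≤n n≤∣X∣) 0<∣W∣
        (λ x E⁵x≤ → ≤-trans (≤-reflexive (sym (m*n/n≡m x (E ^ 5))))
          (/-monoˡ-≤ (E ^ 5) (≤-trans (≤-reflexive (*-comm x (E ^ 5))) (≤-trans E⁵x≤ (≤-reflexive (cong (c̄ *_) length-points))))))
        -- The initial count of copies is 0, but the greedy step cancels `B`, so it starts at
        -- `B = 1`.
        [] (edges N) (λ _ → true) (fromTemplate t) 1 1
        (All.map (λ i<j i≡j → Finₚ.<-irrefl i≡j i<j) (edges-increasing N)) (edges-notParallel N)
        (λ _ _ → refl) (s≤s z≤n)
        (≤-trans (≤-reflexive (trans (cong (λ c → n * (n * c)) (#copies-forb t forb (Fin.fromℕ< 0<k) (λ _ → true)))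
                                     (trans (cong (n *_) (*-zeroʳ n)) (*-zeroʳ n)))) z≤n)
        (≤-reflexive (cong (λ l → E ^ (l * 5 + 1)) (length-edges N)))
        (begin
          E ^ (length (edges N) * 5 + 1) * 1  ≡⟨ *-identityʳ _ ⟩
          E ^ (length (edges N) * 5 + 1)      ≤⟨ M≤n ⟩
          n                                   ≤⟨ n≤∣X∣ ⟩
          length points                       ≡⟨ *-identityˡ _ ⟨
          1 * length points                   ≤⟨ *-monoˡ-≤ (length points) 0<∣W∣ ⟩
          ∣W∣∣X∣                              ≡⟨ *-identityˡ ∣W∣∣X∣ ⟨
          1 * ∣W∣∣X∣                          ∎)
        (≤-reflexive (cong (λ l → 1 + 2 * l) (length-edges N)))
      T = proj₁ result
      t⊆T′ : ∀ i j {c} → c ∈ˢ proj₁ t i j → c ∈ˢ toSubsets T i j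
      t⊆T′ i j {c} c∈t = ∈-tabulate⁺ (λ c → T (i , j , c)) (proj₁ (proj₂ (proj₂ result)) (i , j , c) ([]=⇒lookup c∈t))
      selected = ∈-select⁺ (proj₁ (proj₂ result)) (proj₂ (proj₂ (proj₂ result)))
        λ i j i<j → Product.map id (t⊆T′ i j) (proj₂ t i j i<j)
      nonempty = proj₁ selected
      T∈𝓣 = proj₂ selected

    few-pairs : ∀ t → t ∈ 𝓣 → FewPairs 𝓕 t p q
    few-pairs t t∈𝓣 ps distinct good with ∈-select⁻ (containers [] (edges N) (λ _ → true)) t∈𝓣
    -- `E` absorbs `suc q * D`, which gives the density `1 / suc q`; the factor `suc p` only relaxes
    -- it.
    ... | T , few , nonempty , refl = ≤-trans (*-cancelˡ-≤ E (begin
        E * (length ps * suc q)             ≤⟨ *-monoʳ-≤ E (*-monoˡ-≤ (suc q) pairs≤) ⟩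
        E * (copies * suc q)                ≡⟨ *-assoc E copies (suc q) ⟨
        E * copies * suc q                  ≤⟨ *-monoˡ-≤ (suc q) E*copies≤ ⟩
        D * (n C N) * suc q                 ≡⟨ rotate D (n C N) (suc q) ⟩
        suc q * D * (n C N)                 ≤⟨ *-monoˡ-≤ (n C N) (≤-trans (m≤n+m (suc q * D) (4 + 2 * N)) E₀≤E) ⟩
        E * (n C N)                         ∎)) (m≤m+n (n C N) _)
      where
      copies = #copies T T processed []
      pairs≤ : length ps ≤ copies
      pairs≤ = length-pairs-≤ T nonempty processed (All-ʳ++⁺ (edges-increasing N) []) ps distinct good
      rotate : ∀ a b c → a * b * c ≡ c * a * b
      rotate = solve-∀
      E*copies≤ : E * copies ≤ D * (n C N)
      E*copies≤ = *-cancelˡ-≤ (n * n) ⦃ >-nonZero (*-mono-≤ 1≤n 1≤n) ⦄ (begin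
        n * n * (E * copies)                     ≡⟨ lhs n E copies ⟩
        E * (n * (n * copies))                   ≤⟨ few ⟩
        c̄ * ∣W∣∣X∣                               ≡⟨ cong (c̄ *_) (cong₂ _*_ length-placements length-points) ⟩
        c̄ * (κ * n ^ N * (n * (n * k)))          ≡⟨ rhs c̄ κ (n ^ N) n k ⟩
        n * n * (c̄ * κ * k * n ^ N)              ≤⟨ *-monoʳ-≤ (n * n) (*-monoʳ-≤ (c̄ * κ * k) (n^N≤binomial n N 2N≤n)) ⟩
        n * n * (c̄ * κ * k * (2 ^ N * N ! * (n C N)))  ≡⟨ cong (n * n *_) (*-assoc (c̄ * κ * k) (2 ^ N * N !) (n C N)) ⟨
        n * n * (D * (n C N))                    ∎)
        where
        lhs : ∀ n e c → n * n * (e * c) ≡ e * (n * (n * c))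
        lhs = solve-∀
        rhs : ∀ c κ x n k → c * (κ * x * (n * (n * k))) ≡ n * n * (c * κ * k * x)
        rhs = solve-∀

    log-bound : LogBound k (length 𝓣) (C′ * 128) n m
    log-bound = logBound {k} {length 𝓣} {Q} {E} {C′} {n} {m} 2≤k 0<m 1≤E n< n²≤ (begin
      length 𝓣                                          ≤⟨ length-select-≤ (containers [] (edges N) (λ _ → true)) ⟩
      length (containers [] (edges N) (λ _ → true))     ≤⟨ length-containers-≤ [] (edges N) _ ⟩
      length fingerprints ^ length (edges N)            ≡⟨ cong (length fingerprints ^_) (length-edges N) ⟩
      length fingerprints ^ r                           ≤⟨ ^-monoˡ-≤ r fingerprints≤ ⟩
      (suc (κ * n ^ N * (2 ^ n * 2 ^ n)) ^ maxLetters * suc (n * (n * k)) ^ maxExceptions) ^ r  ≤⟨ proj₁ (proj₂ count) ⟩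
      2 ^ Q                                             ∎) (proj₂ (proj₂ count))
      where
      count = fingerprint-count k N r c̄ {n} {E} {maxLetters} {maxExceptions} 1≤E 3≤r E^≤n n< refl
                (m/n*n≤m (c̄ * (n * (n * k))) (E ^ 5))
      Q = proj₁ count
      fingerprints≤ : length fingerprints ≤ suc (κ * n ^ N * (2 ^ n * 2 ^ n)) ^ maxLetters * suc (n * (n * k)) ^ maxExceptions
      fingerprints≤ = begin
        length fingerprints
          ≡⟨ length-cartesianProductWith _,_ (listsUpTo letters maxLetters) _ ⟩
        length (listsUpTo letters maxLetters) * length (listsUpTo points maxExceptions)
          ≤⟨ *-mono-≤ (length-listsUpTo-≤ letters maxLetters) (length-listsUpTo-≤ points maxExceptions) ⟩
        suc (length letters) ^ maxLetters * suc (length points) ^ maxExceptions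
          ≡⟨ cong₂ (λ a b → suc a ^ maxLetters * suc b ^ maxExceptions) length-letters length-points ⟩
        suc (κ * n ^ N * (2 ^ n * 2 ^ n)) ^ maxLetters * suc (n * (n * k)) ^ maxExceptions ∎

  proof : ∀ 𝓕 n → E₀ ^ (4 * m) ≤ n → Σ (List (Template n k)) λ 𝓣 → IsContainerFamily 𝓕 𝓣
        × (∀ (t : Template n k) → t ∈ 𝓣 → FewPairs 𝓕 t p q) × LogBound k (length 𝓣) (C′ * 128) n m
  proof 𝓕 n n₀≤n with root (4 * m) (*-mono-≤ {1} {4} (s≤s z≤n) 0<m) n
  ... | E , E^≤n , n< = 𝓣 𝓕 n n₀≤n E E^≤n n< , container-family 𝓕 n n₀≤n E E^≤n n<
                      , few-pairs 𝓕 n n₀≤n E E^≤n n< , log-bound 𝓕 n n₀≤n E E^≤n n<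

theorem2p6 : ∀ (k N : ℕ) → 2 ≤ k → 2 ≤ N → ∀ (p q : ℕ)
    → Σ ℕ λ C₀ → Σ ℕ λ n₀
    → ∀ (𝓕 : List (Colouring N k)) → 𝓕 ≢ []
    → ∀ (n : ℕ) → n₀ ≤ n
    → Σ (List (Template n k)) λ 𝓣
    → IsContainerFamily 𝓕 𝓣
    × (∀ (t : Template n k) → t ∈ 𝓣 → FewPairs 𝓕 t p q)
    × LogBound k (length 𝓣) C₀ n (2 * (N C 2) ∸ 1)
theorem2p6 k N 2≤k 2≤N with m≤n⇒m<n∨m≡n 2≤N
... | inj₂ refl = single-edge k 2≤k
... | inj₁ 3≤N  = several-edges k N 2≤k 3≤N
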